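{- Let $M$ be a free $\mathbb{Z}$-module of finite rank $m$, let $\beta$ be a $\mathbb{Z}$-basis of $M$, and let $\varphi\in\operatorname{End}_{\mathbb{Z}}(M)$. Regard $M$ as a $\mathbb{Z}[x]$-module via $x\cdot v=\varphi(v)$. Then $M$ has rational canonical form over $\mathbb{Z}$ if and only if the matrix $A(x)=xI_m-[\varphi]_\beta\in\mathbb{Z}[x]^{m\times m}$ has Smith normal form over $\mathbb{Z}[x]$.
   Context: A matrix $A\in R^{m\times n}$ over a commutative ring $R$ has Smith normal form (SNF) over $R$ if there exist invertible $P\in R^{m\times m}$, $Q\in R^{n\times n}$ such that $B=PAQ$ satisfies $b_{ij}=0$ for $i\ne j$ and the diagonal entries $s_i=b_{ii}$ ($1\le i\le\min\{m,n\}$) satisfy $s_1\mid s_2\mid\cdots\mid s_{\min\{m,n\}}$. $[\varphi]_\beta$ denotes the matrix of $\varphi$ in the basis $\beta$. A $\mathbb{Z}[x]$-module $M$ that is free of finite rank over $\mathbb{Z}$ has rational canonical form (RCF) over $\mathbb{Z}$ if there exist cyclic $\mathbb{Z}[x]$-submodules $V_1,\dots,V_k$ of $M$ with $M=V_1\oplus\cdots\oplus V_k$, such that $\operatorname{Ann}(V_i)=(a_i(x))$ with each $a_i(x)\in\mathbb{Z}[x]$ monic and non-constant and $a_1(x)\mid a_2(x)\mid\cdots\mid a_k(x)$. An endomorphism $\varphi$ of a free $\mathbb{Z}$-module of finite rank has RCF over $\mathbb{Z}$ if the associated $\mathbb{Z}[x]$-module (with $x$ acting by $\varphi$) has RCF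 over $\mathbb{Z}$. -}

module Defs where

open import Algebra.Bundles using (CommutativeRing; CommutativeMonoid)
open import Algebra.Module.Bundles using (Module)
open import Algebra.Module.Structures.Biased using (IsModuleFromLeft)
open import Algebra.Module.Morphism.Structures using (module ModuleMorphisms)
import Algebra.Properties.CommutativeMonoid.Sum as Sum
import Algebra.Properties.CommutativeSemigroup as CommutativeSemigroupProperties
import Algebra.Properties.Ring as RingProperties
import Algebra.Properties.Semiring.Divisibility as Divisibility
open import Data.Bool.Base using (if_then_else_)
open import Data.Fin.Base using (Fin; toℕ; inject≤)
open import Data.Fin.Properties using (_≟_)
import Data.Integer.Properties as ℤ
open import Data.List.Base using (List; []; _∷_; map)
open import Data.Nat.Base using (ℕ; zero; suc; _⊓_; _<_)
open import Data.Nat.Properties using (m⊓n≤m; m⊓n≤n)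
open import Data.Product.Base using (_×_; _,_; ∃-syntax; proj₁)
open import Data.Vec.Functional using (Vector)
open import Level using (Level; _⊔_; 0ℓ) renaming (suc to lsuc)
open import Relation.Binary.PropositionalEquality.Core using (_≡_; _≢_)
import Relation.Binary.Reasoning.Setoid as ≈-Reasoning
open import Relation.Nullary.Decidable.Core using (does)
open import Relation.Nullary.Negation.Core using (¬_)
open import Relation.Unary using (Pred; _∈_; _≐_)

module Matrices {c ℓ} (R : CommutativeRing c ℓ) where
  open CommutativeRing R
  open Sum +-commutativeMonoid using (sum)
  open Divisibility semiring using (_∣_)

  infix  4 _≋_
  infixl 6 _⊟_
  infixl 7 _⊠_
  infixr 7 _⊡_

  Matrix : ℕ → ℕ → Set c
  Matrix m n = Fin m → Fin n → Carrier

  _≋_ : ∀ {m n} → Matrix m n → Matrix m n → Set ℓ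
  A ≋ B = ∀ i j → A i j ≈ B i j

  𝟙 : ∀ n → Matrix n n
  𝟙 n i j = if does (i ≟ j) then 1# else 0#

  _⊟_ : ∀ {m n} → Matrix m n → Matrix m n → Matrix m n
  (A ⊟ B) i j = A i j - B i j

  _⊡_ : ∀ {m n} → Carrier → Matrix m n → Matrix m n
  (r ⊡ A) i j = r * A i j

  _⊠_ : ∀ {m n p} → Matrix m n → Matrix n p → Matrix m p
  (A ⊠ B) i k = sum (λ j → A i j * B j k)

  Invertible : ∀ {n} → Matrix n n → Set (c ⊔ ℓ)
  Invertible {n} P = ∃[ P⁻¹ ] P ⊠ P⁻¹ ≋ 𝟙 n × P⁻¹ ⊠ P ≋ 𝟙 n

  DivisibilityChain : ∀ {n} → Vector Carrier n → Set (c ⊔ ℓ)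
  DivisibilityChain s = ∀ i j → toℕ j ≡ suc (toℕ i) → s i ∣ s j

  diagonal : ∀ {m n} → Matrix m n → Vector Carrier (m ⊓ n)
  diagonal {m} {n} B i = B (inject≤ i (m⊓n≤m m n)) (inject≤ i (m⊓n≤n m n))

  record IsSmith {m n} (B : Matrix m n) : Set (c ⊔ ℓ) where
    field
      off-diagonal : ∀ i j → toℕ i ≢ toℕ j → B i j ≈ 0#
      chain        : DivisibilityChain (diagonal B)

  HasSNF : ∀ {m n} → Matrix m n → Set (c ⊔ ℓ)
  HasSNF {m} {n} A =
    ∃[ P ] ∃[ Q ] Invertible {m} P × Invertible {n} Q × IsSmith (P ⊠ A ⊠ Q)

-- A polynomial is the list of its coefficients, constant term first.
-- Trailing zeros are allowed, so polynomials are compared by _≈ₚ_.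
module Polynomials {c ℓ} (R : CommutativeRing c ℓ) where
  open CommutativeRing R hiding (zero)

  Poly : Set c
  Poly = List Carrier

  coeff : Poly → ℕ → Carrier
  coeff []      _       = 0#
  coeff (a ∷ p) zero    = a
  coeff (a ∷ p) (suc n) = coeff p n

  infix  4 _≈ₚ_
  infixl 6 _+ₚ_
  infixl 7 _*ₚ_ _·_

  record _≈ₚ_ (p q : Poly) : Set ℓ where
    field
      at : ∀ n → coeff p n ≈ coeff q n

  open _≈ₚ_ public

  _+ₚ_ : Poly → Poly → Poly
  []      +ₚ q       = q
  (a ∷ p) +ₚ []      = a ∷ p
  (a ∷ p) +ₚ (b ∷ q) = (a + b) ∷ (p +ₚ q)

  -ₚ_ : Poly → Poly
  -ₚ_ = map (-_)

  _·_ : Carrier → Poly → Poly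
  a · p = map (a *_) p

  -- (a + x p) q = a q + x (p q)
  _*ₚ_ : Poly → Poly → Poly
  []      *ₚ q = []
  (a ∷ p) *ₚ q = a · q +ₚ (0# ∷ p *ₚ q)

  0ₚ 1ₚ X : Poly
  0ₚ = []
  1ₚ = 1# ∷ []
  X  = 0# ∷ 1# ∷ []

  const : Carrier → Poly
  const a = a ∷ []

  Monic : Poly → Set ℓ
  Monic p = ∃[ n ] coeff p n ≈ 1# × (∀ k → n < k → coeff p k ≈ 0#)

  Constant : Poly → Set (c ⊔ ℓ)
  Constant p = ∃[ a ] p ≈ₚ const a

  private
    open module + = CommutativeSemigroupProperties
      (CommutativeMonoid.commutativeSemigroup +-commutativeMonoid) using (interchange; x∙yz≈y∙xz)
    open RingProperties ring using (-0#≈0#)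

  ≈ₚ-refl : ∀ {p} → p ≈ₚ p
  ≈ₚ-refl .at n = refl

  ≈ₚ-sym : ∀ {p q} → p ≈ₚ q → q ≈ₚ p
  ≈ₚ-sym e .at n = sym (at e n)

  ≈ₚ-trans : ∀ {p q r} → p ≈ₚ q → q ≈ₚ r → p ≈ₚ r
  ≈ₚ-trans e f .at n = trans (at e n) (at f n)

  coeff-+ : ∀ p q n → coeff (p +ₚ q) n ≈ coeff p n + coeff q n
  coeff-+ []      q       n       = sym (+-identityˡ _)
  coeff-+ (a ∷ p) []      n       = sym (+-identityʳ _)
  coeff-+ (a ∷ p) (b ∷ q) zero    = refl
  coeff-+ (a ∷ p) (b ∷ q) (suc n) = coeff-+ p q n

  coeff-neg : ∀ p n → coeff (-ₚ p) n ≈ - coeff p n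
  coeff-neg []      n       = sym -0#≈0#
  coeff-neg (a ∷ p) zero    = refl
  coeff-neg (a ∷ p) (suc n) = coeff-neg p n

  coeff-· : ∀ a p n → coeff (a · p) n ≈ a * coeff p n
  coeff-· a []      n       = sym (zeroʳ a)
  coeff-· a (b ∷ p) zero    = refl
  coeff-· a (b ∷ p) (suc n) = coeff-· a p n

  ∷-cong : ∀ {a b p q} → a ≈ b → p ≈ₚ q → a ∷ p ≈ₚ b ∷ q
  ∷-cong e f .at zero    = e
  ∷-cong e f .at (suc n) = at f n

  ∷-injectiveʳ : ∀ {a b p q} → a ∷ p ≈ₚ b ∷ q → p ≈ₚ q
  ∷-injectiveʳ e .at n = at e (suc n)

  tail≈0 : ∀ {a p} → a ∷ p ≈ₚ 0ₚ → p ≈ₚ 0ₚ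
  tail≈0 e .at n = at e (suc n)

  0∷0≈0 : ∀ {p} → p ≈ₚ 0ₚ → 0# ∷ p ≈ₚ 0ₚ
  0∷0≈0 e .at zero    = refl
  0∷0≈0 e .at (suc n) = at e n

  +ₚ-cong : ∀ {p p′ q q′} → p ≈ₚ p′ → q ≈ₚ q′ → p +ₚ q ≈ₚ p′ +ₚ q′
  +ₚ-cong {p} {p′} {q} {q′} e f .at n =
    trans (coeff-+ p q n) (trans (+-cong (at e n) (at f n)) (sym (coeff-+ p′ q′ n)))

  +ₚ-assoc : ∀ p q r → (p +ₚ q) +ₚ r ≈ₚ p +ₚ (q +ₚ r)
  +ₚ-assoc p q r .at n = begin
    coeff ((p +ₚ q) +ₚ r) n               ≈⟨ coeff-+ (p +ₚ q) r n ⟩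
    coeff (p +ₚ q) n + coeff r n          ≈⟨ +-congʳ (coeff-+ p q n) ⟩
    coeff p n + coeff q n + coeff r n     ≈⟨ +-assoc _ _ _ ⟩
    coeff p n + (coeff q n + coeff r n)   ≈⟨ +-congˡ (coeff-+ q r n) ⟨
    coeff p n + coeff (q +ₚ r) n          ≈⟨ coeff-+ p (q +ₚ r) n ⟨
    coeff (p +ₚ (q +ₚ r)) n               ∎
    where open ≈-Reasoning setoid

  +ₚ-comm : ∀ p q → p +ₚ q ≈ₚ q +ₚ p
  +ₚ-comm p q .at n = trans (coeff-+ p q n) (trans (+-comm _ _) (sym (coeff-+ q p n)))

  +ₚ-identityʳ : ∀ p → p +ₚ 0ₚ ≈ₚ p
  +ₚ-identityʳ p .at n = trans (coeff-+ p 0ₚ n) (+-identityʳ _)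

  -ₚ-cong : ∀ {p q} → p ≈ₚ q → -ₚ p ≈ₚ -ₚ q
  -ₚ-cong {p} {q} e .at n = trans (coeff-neg p n) (trans (-‿cong (at e n)) (sym (coeff-neg q n)))

  -ₚ-inverseˡ : ∀ p → (-ₚ p) +ₚ p ≈ₚ 0ₚ
  -ₚ-inverseˡ p .at n =
    trans (coeff-+ (-ₚ p) p n) (trans (+-congʳ (coeff-neg p n)) (-‿inverseˡ _))

  -ₚ-inverseʳ : ∀ p → p +ₚ (-ₚ p) ≈ₚ 0ₚ
  -ₚ-inverseʳ p = ≈ₚ-trans (+ₚ-comm p (-ₚ p)) (-ₚ-inverseˡ p)

  +ₚ-interchange : ∀ p q r s → (p +ₚ q) +ₚ (r +ₚ s) ≈ₚ (p +ₚ r) +ₚ (q +ₚ s)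
  +ₚ-interchange p q r s .at n =
    trans (coeff₄ p q r s) (trans (interchange _ _ _ _) (sym (coeff₄ p r q s)))
    where
    coeff₄ : ∀ p q r s → coeff ((p +ₚ q) +ₚ (r +ₚ s)) n
                       ≈ (coeff p n + coeff q n) + (coeff r n + coeff s n)
    coeff₄ p q r s = trans (coeff-+ (p +ₚ q) (r +ₚ s) n)
                           (+-cong (coeff-+ p q n) (coeff-+ r s n))

  ·-cong : ∀ {a b p q} → a ≈ b → p ≈ₚ q → a · p ≈ₚ b · q
  ·-cong {a} {b} {p} {q} e f .at n =
    trans (coeff-· a p n) (trans (*-cong e (at f n)) (sym (coeff-· b q n)))

  ·-zeroˡ : ∀ p → 0# · p ≈ₚ 0ₚ
  ·-zeroˡ p .at n = trans (coeff-· 0# p n) (zeroˡ _)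

  ·-identityˡ : ∀ p → 1# · p ≈ₚ p
  ·-identityˡ p .at n = trans (coeff-· 1# p n) (*-identityˡ _)

  ·-distribʳ : ∀ a b p → (a + b) · p ≈ₚ a · p +ₚ b · p
  ·-distribʳ a b p .at n = begin
    coeff ((a + b) · p) n             ≈⟨ coeff-· (a + b) p n ⟩
    (a + b) * coeff p n               ≈⟨ distribʳ _ _ _ ⟩
    a * coeff p n + b * coeff p n     ≈⟨ +-cong (coeff-· a p n) (coeff-· b p n) ⟨
    coeff (a · p) n + coeff (b · p) n ≈⟨ coeff-+ (a · p) (b · p) n ⟨
    coeff (a · p +ₚ b · p) n          ∎
    where open ≈-Reasoning setoid

  ·-distribˡ : ∀ a p q → a · (p +ₚ q) ≈ₚ a · p +ₚ a · q
  ·-distribˡ a p q .at n = begin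
    coeff (a · (p +ₚ q)) n            ≈⟨ coeff-· a (p +ₚ q) n ⟩
    a * coeff (p +ₚ q) n              ≈⟨ *-congˡ (coeff-+ p q n) ⟩
    a * (coeff p n + coeff q n)       ≈⟨ distribˡ _ _ _ ⟩
    a * coeff p n + a * coeff q n     ≈⟨ +-cong (coeff-· a p n) (coeff-· a q n) ⟨
    coeff (a · p) n + coeff (a · q) n ≈⟨ coeff-+ (a · p) (a · q) n ⟨
    coeff (a · p +ₚ a · q) n          ∎
    where open ≈-Reasoning setoid

  ·-assoc : ∀ a b p → (a * b) · p ≈ₚ a · (b · p)
  ·-assoc a b p .at n = begin
    coeff ((a * b) · p) n   ≈⟨ coeff-· (a * b) p n ⟩
    a * b * coeff p n       ≈⟨ *-assoc _ _ _ ⟩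
    a * (b * coeff p n)     ≈⟨ *-congˡ (coeff-· b p n) ⟨
    a * coeff (b · p) n     ≈⟨ coeff-· a (b · p) n ⟨
    coeff (a · (b · p)) n   ∎
    where open ≈-Reasoning setoid

  *ₚ-zeroˡ : ∀ p q → p ≈ₚ 0ₚ → p *ₚ q ≈ₚ 0ₚ
  *ₚ-zeroˡ []      q e = ≈ₚ-refl
  *ₚ-zeroˡ (a ∷ p) q e =
    +ₚ-cong (≈ₚ-trans (·-cong (at e 0) ≈ₚ-refl) (·-zeroˡ q))
                    (0∷0≈0 (*ₚ-zeroˡ p q (tail≈0 e)))

  *ₚ-congʳ : ∀ p p′ q → p ≈ₚ p′ → p *ₚ q ≈ₚ p′ *ₚ q
  *ₚ-congʳ []      p′       q e = ≈ₚ-sym (*ₚ-zeroˡ p′ q (≈ₚ-sym e))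
  *ₚ-congʳ (a ∷ p) []       q e = *ₚ-zeroˡ (a ∷ p) q e
  *ₚ-congʳ (a ∷ p) (b ∷ p′) q e =
    +ₚ-cong (·-cong (at e 0) ≈ₚ-refl)
            (∷-cong refl (*ₚ-congʳ p p′ q (∷-injectiveʳ e)))

  *ₚ-congˡ : ∀ p q q′ → q ≈ₚ q′ → p *ₚ q ≈ₚ p *ₚ q′
  *ₚ-congˡ []      q q′ e = ≈ₚ-refl
  *ₚ-congˡ (a ∷ p) q q′ e =
    +ₚ-cong (·-cong refl e) (∷-cong refl (*ₚ-congˡ p q q′ e))

  *ₚ-cong : ∀ {p p′ q q′} → p ≈ₚ p′ → q ≈ₚ q′ → p *ₚ q ≈ₚ p′ *ₚ q′
  *ₚ-cong {p} {p′} {q} {q′} e f = ≈ₚ-trans (*ₚ-congʳ p p′ q e) (*ₚ-congˡ p′ q q′ f)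

  0∷-+ : ∀ p q → 0# ∷ (p +ₚ q) ≈ₚ (0# ∷ p) +ₚ (0# ∷ q)
  0∷-+ p q = ∷-cong (sym (+-identityʳ 0#)) ≈ₚ-refl

  *ₚ-distribʳ : ∀ q p p′ → (p +ₚ p′) *ₚ q ≈ₚ p *ₚ q +ₚ p′ *ₚ q
  *ₚ-distribʳ q []      p′       = ≈ₚ-refl
  *ₚ-distribʳ q (a ∷ p) []       = ≈ₚ-sym (+ₚ-identityʳ ((a ∷ p) *ₚ q))
  *ₚ-distribʳ q (a ∷ p) (b ∷ p′) =
    ≈ₚ-trans
      (+ₚ-cong (·-distribʳ a b q)
        (≈ₚ-trans (∷-cong refl (*ₚ-distribʳ q p p′)) (0∷-+ (p *ₚ q) (p′ *ₚ q))))
      (+ₚ-interchange (a · q) (b · q) (0# ∷ p *ₚ q) (0# ∷ p′ *ₚ q))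

  *ₚ-zeroʳ : ∀ p → p *ₚ 0ₚ ≈ₚ 0ₚ
  *ₚ-zeroʳ []      = ≈ₚ-refl
  *ₚ-zeroʳ (a ∷ p) = 0∷0≈0 (*ₚ-zeroʳ p)

  *ₚ-∷ : ∀ p b q → p *ₚ (b ∷ q) ≈ₚ b · p +ₚ (0# ∷ p *ₚ q)
  *ₚ-∷ []      b q = ≈ₚ-sym (0∷0≈0 ≈ₚ-refl)
  *ₚ-∷ (a ∷ p) b q = ∷-cong (+-congʳ (*-comm a b)) tails
    where
    tails : a · q +ₚ p *ₚ (b ∷ q) ≈ₚ b · p +ₚ (a · q +ₚ (0# ∷ p *ₚ q))
    tails .at n = begin
      coeff (a · q +ₚ p *ₚ (b ∷ q)) n                               ≈⟨ at (+ₚ-cong {a · q} ≈ₚ-refl (*ₚ-∷ p b q)) n ⟩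
      coeff (a · q +ₚ (b · p +ₚ (0# ∷ p *ₚ q))) n                   ≈⟨ coeff₃ (a · q) (b · p) (0# ∷ p *ₚ q) ⟩
      coeff (a · q) n + (coeff (b · p) n + coeff (0# ∷ p *ₚ q) n)   ≈⟨ x∙yz≈y∙xz _ _ _ ⟩
      coeff (b · p) n + (coeff (a · q) n + coeff (0# ∷ p *ₚ q) n)   ≈⟨ coeff₃ (b · p) (a · q) (0# ∷ p *ₚ q) ⟨
      coeff (b · p +ₚ (a · q +ₚ (0# ∷ p *ₚ q))) n                   ∎
      where
      open ≈-Reasoning setoid
      coeff₃ : ∀ p q r → coeff (p +ₚ (q +ₚ r)) n ≈ coeff p n + (coeff q n + coeff r n)
      coeff₃ p q r = trans (coeff-+ p (q +ₚ r) n) (+-congˡ (coeff-+ q r n))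

  *ₚ-comm : ∀ p q → p *ₚ q ≈ₚ q *ₚ p
  *ₚ-comm []      q = ≈ₚ-sym (*ₚ-zeroʳ q)
  *ₚ-comm (a ∷ p) q =
    ≈ₚ-trans (+ₚ-cong ≈ₚ-refl (∷-cong refl (*ₚ-comm p q))) (≈ₚ-sym (*ₚ-∷ q a p))

  *ₚ-distribˡ : ∀ p q q′ → p *ₚ (q +ₚ q′) ≈ₚ p *ₚ q +ₚ p *ₚ q′
  *ₚ-distribˡ p q q′ =
    ≈ₚ-trans (*ₚ-comm p (q +ₚ q′))
      (≈ₚ-trans (*ₚ-distribʳ p q q′) (+ₚ-cong (*ₚ-comm q p) (*ₚ-comm q′ p)))

  ·-*ₚ : ∀ a p q → (a · p) *ₚ q ≈ₚ a · (p *ₚ q)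
  ·-*ₚ a []      q = ≈ₚ-refl
  ·-*ₚ a (b ∷ p) q =
    ≈ₚ-trans (+ₚ-cong (·-assoc a b q) (∷-cong (sym (zeroʳ a)) (·-*ₚ a p q)))
             (≈ₚ-sym (·-distribˡ a (b · q) (0# ∷ p *ₚ q)))

  0∷-*ₚ : ∀ p q → (0# ∷ p) *ₚ q ≈ₚ 0# ∷ p *ₚ q
  0∷-*ₚ p q = +ₚ-cong (·-zeroˡ q) ≈ₚ-refl

  *ₚ-assoc : ∀ p q r → (p *ₚ q) *ₚ r ≈ₚ p *ₚ (q *ₚ r)
  *ₚ-assoc []      q r = ≈ₚ-refl
  *ₚ-assoc (a ∷ p) q r =
    ≈ₚ-trans (*ₚ-distribʳ r (a · q) (0# ∷ p *ₚ q))
      (+ₚ-cong (·-*ₚ a q r)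
        (≈ₚ-trans (0∷-*ₚ (p *ₚ q) r) (∷-cong refl (*ₚ-assoc p q r))))

  *ₚ-identityˡ : ∀ p → 1ₚ *ₚ p ≈ₚ p
  *ₚ-identityˡ p =
    ≈ₚ-trans (+ₚ-cong (·-identityˡ p) (0∷0≈0 ≈ₚ-refl)) (+ₚ-identityʳ p)

  *ₚ-identityʳ : ∀ p → p *ₚ 1ₚ ≈ₚ p
  *ₚ-identityʳ p = ≈ₚ-trans (*ₚ-comm p 1ₚ) (*ₚ-identityˡ p)

  polyRing : CommutativeRing c ℓ
  polyRing = record
    { Carrier = Poly
    ; _≈_     = _≈ₚ_
    ; _+_     = _+ₚ_
    ; _*_     = _*ₚ_
    ; -_      = -ₚ_
    ; 0#      = 0ₚ
    ; 1#      = 1ₚ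
    ; isCommutativeRing = record
      { isRing = record
        { +-isAbelianGroup = record
          { isGroup = record
            { isMonoid = record
              { isSemigroup = record
                { isMagma = record
                  { isEquivalence = record
                    { refl  = ≈ₚ-refl
                    ; sym   = ≈ₚ-sym
                    ; trans = ≈ₚ-trans
                    }
                  ; ∙-cong = +ₚ-cong
                  }
                ; assoc = +ₚ-assoc
                }
              ; identity = (λ p → ≈ₚ-refl) , +ₚ-identityʳ
              }
            ; inverse = -ₚ-inverseˡ , -ₚ-inverseʳ
            ; ⁻¹-cong = -ₚ-cong
            }
          ; comm = +ₚ-comm
          }
        ; *-cong     = *ₚ-cong
        ; *-assoc    = *ₚ-assoc
        ; *-identity = *ₚ-identityˡ , *ₚ-identityʳ
        ; distrib    = *ₚ-distribˡ , *ₚ-distribʳ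
        }
      ; *-comm = *ₚ-comm
      }
    }

module Modules {c ℓ m ℓm} {R : CommutativeRing c ℓ} (M : Module R m ℓm) where
  open CommutativeRing R using (Carrier; _≈_; 0#)
  open Module M
  open Sum +ᴹ-commutativeMonoid using (sum)
  open ModuleMorphisms rawModule rawModule using (IsModuleHomomorphism)

  record Submodule p : Set (c ⊔ m ⊔ ℓm ⊔ lsuc p) where
    field
      Member    : Pred Carrierᴹ p
      resp      : ∀ {v w} → v ≈ᴹ w → v ∈ Member → w ∈ Member
      0ᴹ-closed : 0ᴹ ∈ Member
      +ᴹ-closed : ∀ {v w} → v ∈ Member → w ∈ Member → (v +ᴹ w) ∈ Member
      *ₗ-closed : ∀ r {v} → v ∈ Member → (r *ₗ v) ∈ Member

  open Submodule public using (Member)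

  private variable
    p : Level

  IsCyclic : Submodule p → Set (c ⊔ m ⊔ ℓm ⊔ p)
  IsCyclic V = ∃[ v ] Member V ≐ (λ w → ∃[ r ] r *ₗ v ≈ᴹ w)

  Ann : Submodule p → Pred Carrier (m ⊔ ℓm ⊔ p)
  Ann V r = ∀ v → v ∈ Member V → r *ₗ v ≈ᴹ 0ᴹ

  record IsInternalDirectSum {k} (V : Fin k → Submodule p) : Set (m ⊔ ℓm ⊔ p) where
    field
      decompose : ∀ v → ∃[ w ] (∀ i → w i ∈ Member (V i)) × sum w ≈ᴹ v
      unique    : ∀ (w w′ : Vector Carrierᴹ k) →
                  (∀ i → w i ∈ Member (V i)) → (∀ i → w′ i ∈ Member (V i)) →
                  sum w ≈ᴹ sum w′ → ∀ i → w i ≈ᴹ w′ i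

  record IsBasis {n} (β : Vector Carrierᴹ n) : Set (c ⊔ ℓ ⊔ m ⊔ ℓm) where
    field
      linearlyIndependent : ∀ (a : Vector Carrier n) →
                            sum (λ i → a i *ₗ β i) ≈ᴹ 0ᴹ → ∀ i → a i ≈ 0#
      spanning            : ∀ v → ∃[ a ] sum (λ i → a i *ₗ β i) ≈ᴹ v

    coordinates : Carrierᴹ → Vector Carrier n
    coordinates v = proj₁ (spanning v)

  record End : Set (c ⊔ m ⊔ ℓm) where
    field
      fun                  : Carrierᴹ → Carrierᴹ
      isModuleHomomorphism : IsModuleHomomorphism fun

    open IsModuleHomomorphism isModuleHomomorphism public

  -- Column j holds the coordinates of φ(βⱼ), which linear independence makes
  -- unique up to _≈_.
  matrixOf : ∀ {n} {β : Vector Carrierᴹ n} → IsBasis β → End → Matrices.Matrix R n n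
  matrixOf {β = β} isBasis φ i j = IsBasis.coordinates isBasis (End.fun φ (β j)) i

module _ {c ℓ m ℓm} {R : CommutativeRing c ℓ} (M : Module R m ℓm) (φ : Modules.End M) where
  open CommutativeRing R using (_≈_; _+_; _*_; 0#; 1#; refl)
  open Polynomials R
  open Module M
  open Modules.End φ using (fun; ⟦⟧-cong; +ᴹ-homo; 0ᴹ-homo; *ₗ-homo)

  private
    open module +ᴹ = CommutativeSemigroupProperties
      (CommutativeMonoid.commutativeSemigroup +ᴹ-commutativeMonoid) using (interchange)
    open ≈-Reasoning ≈ᴹ-setoid

  -- Horner's rule: (a + x p) v = a v + φ(p v)
  act : Poly → Carrierᴹ → Carrierᴹ
  act []      v = 0ᴹ
  act (a ∷ p) v = a *ₗ v +ᴹ fun (act p v)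

  act-zeroˡ : ∀ p v → p ≈ₚ 0ₚ → act p v ≈ᴹ 0ᴹ
  act-zeroˡ []      v e = ≈ᴹ-refl
  act-zeroˡ (a ∷ p) v e = begin
    a *ₗ v +ᴹ fun (act p v)  ≈⟨ +ᴹ-cong (*ₗ-congʳ (at e 0)) (⟦⟧-cong (act-zeroˡ p v (tail≈0 e))) ⟩
    0# *ₗ v +ᴹ fun 0ᴹ        ≈⟨ +ᴹ-cong (*ₗ-zeroˡ v) 0ᴹ-homo ⟩
    0ᴹ +ᴹ 0ᴹ                 ≈⟨ +ᴹ-identityˡ 0ᴹ ⟩
    0ᴹ                       ∎

  act-cong : ∀ p q {v w} → p ≈ₚ q → v ≈ᴹ w → act p v ≈ᴹ act q w
  act-cong []      q       {w = w} e f = ≈ᴹ-sym (act-zeroˡ q w (≈ₚ-sym e))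
  act-cong (a ∷ p) []      {v = v} e f = act-zeroˡ (a ∷ p) v e
  act-cong (a ∷ p) (b ∷ q)         e f =
    +ᴹ-cong (*ₗ-cong (at e 0) f) (⟦⟧-cong (act-cong p q (∷-injectiveʳ e) f))

  act-distribʳ : ∀ v p q → act (p +ₚ q) v ≈ᴹ act p v +ᴹ act q v
  act-distribʳ v []      q       = ≈ᴹ-sym (+ᴹ-identityˡ _)
  act-distribʳ v (a ∷ p) []      = ≈ᴹ-sym (+ᴹ-identityʳ _)
  act-distribʳ v (a ∷ p) (b ∷ q) = begin
    (a + b) *ₗ v +ᴹ fun (act (p +ₚ q) v)
      ≈⟨ +ᴹ-cong (*ₗ-distribʳ v a b) (≈ᴹ-trans (⟦⟧-cong (act-distribʳ v p q)) (+ᴹ-homo _ _)) ⟩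
    (a *ₗ v +ᴹ b *ₗ v) +ᴹ (fun (act p v) +ᴹ fun (act q v))
      ≈⟨ interchange _ _ _ _ ⟩
    (a *ₗ v +ᴹ fun (act p v)) +ᴹ (b *ₗ v +ᴹ fun (act q v))
      ∎

  act-distribˡ : ∀ p v w → act p (v +ᴹ w) ≈ᴹ act p v +ᴹ act p w
  act-distribˡ []      v w = ≈ᴹ-sym (+ᴹ-identityˡ _)
  act-distribˡ (a ∷ p) v w = begin
    a *ₗ (v +ᴹ w) +ᴹ fun (act p (v +ᴹ w))
      ≈⟨ +ᴹ-cong (*ₗ-distribˡ a v w) (≈ᴹ-trans (⟦⟧-cong (act-distribˡ p v w)) (+ᴹ-homo _ _)) ⟩
    (a *ₗ v +ᴹ a *ₗ w) +ᴹ (fun (act p v) +ᴹ fun (act p w))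
      ≈⟨ interchange _ _ _ _ ⟩
    (a *ₗ v +ᴹ fun (act p v)) +ᴹ (a *ₗ w +ᴹ fun (act p w))
      ∎

  act-zeroʳ : ∀ p → act p 0ᴹ ≈ᴹ 0ᴹ
  act-zeroʳ []      = ≈ᴹ-refl
  act-zeroʳ (a ∷ p) = begin
    a *ₗ 0ᴹ +ᴹ fun (act p 0ᴹ)  ≈⟨ +ᴹ-cong (*ₗ-zeroʳ a) (≈ᴹ-trans (⟦⟧-cong (act-zeroʳ p)) 0ᴹ-homo) ⟩
    0ᴹ +ᴹ 0ᴹ                   ≈⟨ +ᴹ-identityˡ 0ᴹ ⟩
    0ᴹ                         ∎

  act-identityˡ : ∀ v → act 1ₚ v ≈ᴹ v
  act-identityˡ v = begin
    1# *ₗ v +ᴹ fun 0ᴹ  ≈⟨ +ᴹ-cong (*ₗ-identityˡ v) 0ᴹ-homo ⟩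
    v +ᴹ 0ᴹ            ≈⟨ +ᴹ-identityʳ v ⟩
    v                  ∎

  act-· : ∀ a p v → act (a · p) v ≈ᴹ a *ₗ act p v
  act-· a []      v = ≈ᴹ-sym (*ₗ-zeroʳ a)
  act-· a (b ∷ p) v = begin
    (a * b) *ₗ v +ᴹ fun (act (a · p) v)
      ≈⟨ +ᴹ-cong (*ₗ-assoc a b v) (≈ᴹ-trans (⟦⟧-cong (act-· a p v)) (*ₗ-homo a _)) ⟩
    a *ₗ (b *ₗ v) +ᴹ a *ₗ fun (act p v)
      ≈⟨ *ₗ-distribˡ a _ _ ⟨
    a *ₗ (b *ₗ v +ᴹ fun (act p v))
      ∎

  act-assoc : ∀ p q v → act (p *ₚ q) v ≈ᴹ act p (act q v)
  act-assoc []      q v = ≈ᴹ-refl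
  act-assoc (a ∷ p) q v = begin
    act (a · q +ₚ (0# ∷ p *ₚ q)) v
      ≈⟨ act-distribʳ v (a · q) (0# ∷ p *ₚ q) ⟩
    act (a · q) v +ᴹ (0# *ₗ v +ᴹ fun (act (p *ₚ q) v))
      ≈⟨ +ᴹ-cong (act-· a q v) (≈ᴹ-trans (+ᴹ-congʳ (*ₗ-zeroˡ v)) (+ᴹ-identityˡ _)) ⟩
    a *ₗ act q v +ᴹ fun (act (p *ₚ q) v)
      ≈⟨ +ᴹ-congˡ (⟦⟧-cong (act-assoc p q v)) ⟩
    a *ₗ act q v +ᴹ fun (act p (act q v))
      ∎

  polyModule : Module polyRing m ℓm
  polyModule = record
    { Carrierᴹ = Carrierᴹ
    ; _≈ᴹ_     = _≈ᴹ_
    ; _+ᴹ_     = _+ᴹ_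
    ; _*ₗ_     = act
    ; _*ᵣ_     = λ v p → act p v
    ; 0ᴹ       = 0ᴹ
    ; -ᴹ_      = -ᴹ_
    ; isModule = IsModuleFromLeft.isModule {commutativeRing = polyRing} record
      { isLeftModule = record
        { isLeftSemimodule = record
          { +ᴹ-isCommutativeMonoid = +ᴹ-isCommutativeMonoid
          ; isPreleftSemimodule = record
            { *ₗ-cong      = λ {p} {q} → act-cong p q
            ; *ₗ-zeroˡ     = λ v → ≈ᴹ-refl
            ; *ₗ-distribʳ  = act-distribʳ
            ; *ₗ-identityˡ = act-identityˡ
            ; *ₗ-assoc     = act-assoc
            ; *ₗ-zeroʳ     = act-zeroʳ
            ; *ₗ-distribˡ  = act-distribˡ
            }
          }
        ; -ᴹ‿cong    = -ᴹ‿cong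
        ; -ᴹ‿inverse = -ᴹ‿inverse
        }
      }
    }

module _ {c ℓ} (R : CommutativeRing c ℓ) where
  open Polynomials R
  open Matrices polyRing using (Matrix; DivisibilityChain; 𝟙; _⊡_; _⊟_)
  open Divisibility (CommutativeRing.semiring polyRing) using (_∣_)

  -- A cyclic submodule {r v} is a predicate at level c ⊔ ℓm, so fixing that
  -- level for the Vᵢ loses none of them.
  record HasRCF {m ℓm} (N : Module polyRing m ℓm) : Set (ℓ ⊔ m ⊔ lsuc (c ⊔ ℓm)) where
    open Modules N
    field
      k           : ℕ
      V           : Fin k → Submodule (c ⊔ ℓm)
      cyclic      : ∀ i → IsCyclic (V i)
      directSum   : IsInternalDirectSum V
      a           : Fin k → Poly
      annihilator : ∀ i → Ann (V i) ≐ (a i ∣_)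
      monic       : ∀ i → Monic (a i)
      nonConstant : ∀ i → ¬ Constant (a i)
      chain       : DivisibilityChain a

  characteristicMatrix : ∀ {n} → Matrices.Matrix R n n → Matrix n n
  characteristicMatrix {n} A = X ⊡ 𝟙 n ⊟ (λ i j → const (A i j))

ℤ-ring : CommutativeRing 0ℓ 0ℓ
ℤ-ring = ℤ.+-*-commutativeRing

ℤ[x] : CommutativeRing 0ℓ 0ℓ
ℤ[x] = Polynomials.polyRing ℤ-ring

{-# OPTIONS --safe #-}
module Submission where

-- Write S = ℤ[x] and A = xI − [φ].  The matrix A is injective and its image is the kernel of
-- the surjection S^m → M sending the i-th unit vector to βᵢ (division by xI − [φ]).
--
-- If P A Q = diag(d), then w = β P⁻¹ decomposes M as ⊕ S wₗ with Ann wₗ = (dₗ).  A monic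
-- polynomial annihilates M, so each dₗ divides a monic polynomial and is therefore monic up to
-- sign; the units form an initial segment and contribute nothing.
--
-- Conversely let M = ⊕ S vᵢ with Ann vᵢ = (aᵢ) and deg aᵢ = 1 + nᵢ.  Division by the aᵢ shows
-- that the x^(j+1) vᵢ (j < nᵢ) followed by the vᵢ form a ℤ-basis γ, of length m by invariance of
-- rank.  So β is carried to γ by GL_m(ℤ), and γ to (0, …, 0, v₁, …, v_k) by a unipotent matrix.
-- The relations of that last tuple are the image of diag(1, …, 1, a₁, …, a_k); two injective
-- matrices with the same image differ by an invertible factor, which supplies Q.

open import Defs
open import Algebra.Bundles using (CommutativeRing)
open import Algebra.Module.Bundles using (Module)
open import Algebra.Module.Construct.TensorUnit using (⟨module⟩)
import Algebra.Properties.AbelianGroup as AbelianGroupProperties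
import Algebra.Properties.CommutativeMonoid.Sum as Sum
import Algebra.Properties.Ring as RingProperties
import Algebra.Properties.Semiring.Divisibility as Divisibility
open import Data.Fin.Base using (Fin; zero; suc; toℕ; inject₁; inject≤; splitAt; join; _↑ˡ_; _↑ʳ_)
open import Data.Fin.Induction using (<-weakInduction)
open import Data.Fin.Properties
  using (_≟_; suc-injective; toℕ-injective; toℕ-inject₁; toℕ-inject≤; toℕ-↑ˡ; toℕ-↑ʳ; toℕ<n; splitAt-↑ˡ; splitAt-↑ʳ; join-splitAt)
open import Data.Integer.Base as ℤ using (+_; -[1+_]; 0ℤ; 1ℤ; -1ℤ)
import Data.Integer.Properties as ℤ
open import Data.List.Base using ([]; _∷_; length; tabulate)
open import Data.List.Properties using (tabulate-cong)
open import Data.Nat.Base as ℕ using (ℕ; zero; suc; _≤_; z≤n; s≤s)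
import Data.Nat.Properties as ℕ
open import Data.Product.Base using (_×_; _,_; ∃-syntax; Σ-syntax; proj₁; proj₂)
open import Data.Sum.Base using (_⊎_; inj₁; inj₂; [_,_]′)
open import Data.Vec.Functional using (Vector)
open import Function.Bundles using (_⇔_; mk⇔)
open import Level using (Level; _⊔_)
open import Relation.Binary.Definitions using (tri<; tri≈; tri>)
open import Relation.Binary.PropositionalEquality.Core as ≡ using (_≡_; _≢_)
open import Relation.Binary.PropositionalEquality.Properties using (module ≡-Reasoning)
import Relation.Binary.Reasoning.Setoid as ≈-Reasoning
open import Relation.Nullary.Decidable.Core using (yes; no)
open import Relation.Nullary.Negation.Core using (¬_; contradiction)

-- `ℤ[x]` is not a principal ideal domain, so elimination cannot diagonalise `A`; its Smith form has
-- to be read off from a decomposition of the module. Comparing relation matrices requires two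
-- generating tuples of the same length that are linked by an invertible matrix. A canonical form
-- supplies only `k ≤ m` generators, and nothing obvious links them, filled up with zeros, to β. The
-- ℤ-basis γ is the bridge: any two bases are linked over ℤ, and each x^(j+1) vᵢ, being a
-- `ℤ[x]`-multiple of vᵢ, can be subtracted away. Each zero carries the relation 1, and the zeros
-- precede the vᵢ so that units head the divisibility chain. The annihilator of M need not be the
-- characteristic polynomial: any monic polynomial will do, so elimination without determinants
-- suffices. Most steps hold over every commutative ring. What is special to ℤ is the behaviour of
-- leading coefficients (no zero divisors, units ±1, decidable equality) and characteristic zero,
-- through which a trace recovers the rank.

-- Linear combinations in a module.

module Linear {c ℓ m ℓm} {R : CommutativeRing c ℓ} (M : Module R m ℓm) where
  open CommutativeRing R hiding (zero)
  open Module M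
  open Sum +ᴹ-commutativeMonoid
  open Sum +-commutativeMonoid using () renaming (sum to sumᴿ)
  open Matrices R using (𝟙)
  open AbelianGroupProperties +ᴹ-abelianGroup using ()
    renaming (inverseˡ-unique to inverseˡ-uniqueᴹ)
  open ≈-Reasoning ≈ᴹ-setoid

  private variable
    n n′ : ℕ

  lin : Vector Carrier n → Vector Carrierᴹ n → Carrierᴹ
  lin p u = sum (λ i → p i *ₗ u i)

  lin-cong : {p q : Vector Carrier n} {u w : Vector Carrierᴹ n} →
             (∀ i → p i ≈ q i) → (∀ i → u i ≈ᴹ w i) → lin p u ≈ᴹ lin q w
  lin-cong p≈q u≈w = sum-cong-≋ (λ i → *ₗ-cong (p≈q i) (u≈w i))

  lin-congʳ : {p q : Vector Carrier n} (u : Vector Carrierᴹ n) →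
              (∀ i → p i ≈ q i) → lin p u ≈ᴹ lin q u
  lin-congʳ u p≈q = lin-cong p≈q (λ _ → ≈ᴹ-refl)

  lin-congˡ : (p : Vector Carrier n) {u w : Vector Carrierᴹ n} →
              (∀ i → u i ≈ᴹ w i) → lin p u ≈ᴹ lin p w
  lin-congˡ p u≈w = lin-cong (λ _ → refl) u≈w

  sum-zero : (f : Vector Carrierᴹ n) → (∀ i → f i ≈ᴹ 0ᴹ) → sum f ≈ᴹ 0ᴹ
  sum-zero {n} f f≈0 = ≈ᴹ-trans (sum-cong-≋ f≈0) (sum-replicate-zero n)

  lin-zeroˡ : {p : Vector Carrier n} (u : Vector Carrierᴹ n) → (∀ i → p i ≈ 0#) → lin p u ≈ᴹ 0ᴹ
  lin-zeroˡ u p≈0 = sum-zero _ (λ i → ≈ᴹ-trans (*ₗ-congʳ (p≈0 i)) (*ₗ-zeroˡ (u i)))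

  lin-zeroʳ : (p : Vector Carrier n) {u : Vector Carrierᴹ n} → (∀ i → u i ≈ᴹ 0ᴹ) → lin p u ≈ᴹ 0ᴹ
  lin-zeroʳ p u≈0 = sum-zero _ (λ i → ≈ᴹ-trans (*ₗ-congˡ (u≈0 i)) (*ₗ-zeroʳ (p i)))

  *ₗ-distrib-sum : ∀ r (f : Vector Carrierᴹ n) → r *ₗ sum f ≈ᴹ sum (λ i → r *ₗ f i)
  *ₗ-distrib-sum {ℕ.zero}  r f = *ₗ-zeroʳ r
  *ₗ-distrib-sum {ℕ.suc n} r f =
    ≈ᴹ-trans (*ₗ-distribˡ r _ _) (+ᴹ-congˡ (*ₗ-distrib-sum r (λ i → f (suc i))))

  sum-distrib-*ₗ : ∀ (p : Vector Carrier n) v → sumᴿ p *ₗ v ≈ᴹ sum (λ i → p i *ₗ v)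
  sum-distrib-*ₗ {ℕ.zero}  p v = *ₗ-zeroˡ v
  sum-distrib-*ₗ {ℕ.suc n} p v =
    ≈ᴹ-trans (*ₗ-distribʳ v _ _) (+ᴹ-congˡ (sum-distrib-*ₗ (λ i → p (suc i)) v))

  *ₗ-lin : ∀ r (p : Vector Carrier n) u → r *ₗ lin p u ≈ᴹ lin (λ i → r * p i) u
  *ₗ-lin r p u = ≈ᴹ-trans (*ₗ-distrib-sum r (λ i → p i *ₗ u i)) (sum-cong-≋ (λ i → ≈ᴹ-sym (*ₗ-assoc r (p i) (u i))))

  *ₗ-lin′ : ∀ r (p : Vector Carrier n) u → r *ₗ lin p u ≈ᴹ lin p (λ i → r *ₗ u i)
  *ₗ-lin′ r p u = ≈ᴹ-trans (*ₗ-lin r p u) (sum-cong-≋ (λ i →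
    ≈ᴹ-trans (*ₗ-congʳ (*-comm r (p i))) (*ₗ-assoc (p i) r (u i))))

  -- Interchange of two finite sums. In the regular module it yields associativity of matrix
  -- products (`mv-⊠`), in a general one the law u(Gp) = (uG)p (`lin-mv`).
  lin-assoc : (p : Vector Carrier n) (B : Fin n → Fin n′ → Carrier) (u : Vector Carrierᴹ n′) →
              lin p (λ l → lin (B l) u) ≈ᴹ lin (λ i → sumᴿ (λ l → p l * B l i)) u
  lin-assoc p B u = begin
    lin p (λ l → lin (B l) u)                      ≈⟨ sum-cong-≋ (λ l → *ₗ-lin (p l) (B l) u) ⟩
    sum (λ l → sum (λ i → (p l * B l i) *ₗ u i))   ≈⟨ ∑-comm (λ l i → (p l * B l i) *ₗ u i) ⟩
    sum (λ i → sum (λ l → (p l * B l i) *ₗ u i))   ≈⟨ sum-cong-≋ (λ i → sum-distrib-*ₗ (λ l → p l * B l i) (u i)) ⟨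
    lin (λ i → sumᴿ (λ l → p l * B l i)) u         ∎

  lin-+ : (p q : Vector Carrier n) (u : Vector Carrierᴹ n) →
          lin (λ i → p i + q i) u ≈ᴹ lin p u +ᴹ lin q u
  lin-+ p q u = ≈ᴹ-trans (sum-cong-≋ (λ i → *ₗ-distribʳ (u i) (p i) (q i))) (∑-distrib-+ (λ i → p i *ₗ u i) (λ i → q i *ₗ u i))

  -‿*ₗ : ∀ r v → (- r) *ₗ v ≈ᴹ -ᴹ (r *ₗ v)
  -‿*ₗ r v = inverseˡ-uniqueᴹ _ _ (begin
    (- r) *ₗ v +ᴹ r *ₗ v  ≈⟨ *ₗ-distribʳ v (- r) r ⟨
    (- r + r) *ₗ v        ≈⟨ *ₗ-congʳ (-‿inverseˡ r) ⟩
    0# *ₗ v               ≈⟨ *ₗ-zeroˡ v ⟩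
    0ᴹ                    ∎)

  lin-neg : (p : Vector Carrier n) (u : Vector Carrierᴹ n) → lin (λ i → - p i) u ≈ᴹ -ᴹ lin p u
  lin-neg p u = inverseˡ-uniqueᴹ _ _ (begin
    lin (λ i → - p i) u +ᴹ lin p u  ≈⟨ lin-+ _ _ u ⟨
    lin (λ i → - p i + p i) u       ≈⟨ lin-zeroˡ u (λ i → -‿inverseˡ (p i)) ⟩
    0ᴹ                              ∎)

  lin-- : (p q : Vector Carrier n) (u : Vector Carrierᴹ n) →
          lin (λ i → p i - q i) u ≈ᴹ lin p u +ᴹ -ᴹ lin q u
  lin-- p q u = ≈ᴹ-trans (lin-+ p _ u) (+ᴹ-congˡ (lin-neg q u))

  ≈ᴹ⇒-≈0 : ∀ {v w} → v ≈ᴹ w → v +ᴹ -ᴹ w ≈ᴹ 0ᴹ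
  ≈ᴹ⇒-≈0 v≈w = ≈ᴹ-trans (+ᴹ-congʳ v≈w) (-ᴹ‿inverseʳ _)

  -≈0⇒≈ᴹ : ∀ {v w} → v +ᴹ -ᴹ w ≈ᴹ 0ᴹ → v ≈ᴹ w
  -≈0⇒≈ᴹ {v} {w} e = begin
    v                    ≈⟨ +ᴹ-identityʳ v ⟨
    v +ᴹ 0ᴹ              ≈⟨ +ᴹ-congˡ (-ᴹ‿inverseˡ w) ⟨
    v +ᴹ (-ᴹ w +ᴹ w)     ≈⟨ +ᴹ-assoc _ _ _ ⟨
    v +ᴹ -ᴹ w +ᴹ w       ≈⟨ +ᴹ-congʳ e ⟩
    0ᴹ +ᴹ w              ≈⟨ +ᴹ-identityˡ w ⟩
    w                    ∎

  lin-𝟙ˡ : ∀ {n} (l : Fin n) (u : Vector Carrierᴹ n) → lin (𝟙 n l) u ≈ᴹ u l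
  lin-𝟙ˡ {ℕ.suc n} zero u = begin
    1# *ₗ u zero +ᴹ lin {n} (λ _ → 0#) (λ i → u (suc i)) ≈⟨ +ᴹ-cong (*ₗ-identityˡ _) (lin-zeroˡ (λ i → u (suc i)) (λ _ → refl)) ⟩
    u zero +ᴹ 0ᴹ                                         ≈⟨ +ᴹ-identityʳ _ ⟩
    u zero                                               ∎
  lin-𝟙ˡ {ℕ.suc n} (suc l) u = begin
    0# *ₗ u zero +ᴹ lin (𝟙 n l) (λ i → u (suc i))  ≈⟨ +ᴹ-cong (*ₗ-zeroˡ _) (lin-𝟙ˡ l (λ i → u (suc i))) ⟩
    0ᴹ +ᴹ u (suc l)                                ≈⟨ +ᴹ-identityˡ _ ⟩
    u (suc l)                                      ∎

  𝟙-sym : ∀ {n} (i j : Fin n) → 𝟙 n i j ≡ 𝟙 n j i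
  𝟙-sym zero    zero    = ≡.refl
  𝟙-sym zero    (suc j) = ≡.refl
  𝟙-sym (suc i) zero    = ≡.refl
  𝟙-sym (suc i) (suc j) = 𝟙-sym i j

  𝟙-diagonal : ∀ {n} (i : Fin n) → 𝟙 n i i ≡ 1#
  𝟙-diagonal zero    = ≡.refl
  𝟙-diagonal (suc i) = 𝟙-diagonal i

  𝟙-off-diagonal : ∀ {n} (i j : Fin n) → i ≢ j → 𝟙 n i j ≡ 0#
  𝟙-off-diagonal zero    zero    i≢j = contradiction ≡.refl i≢j
  𝟙-off-diagonal zero    (suc j) i≢j = ≡.refl
  𝟙-off-diagonal (suc i) zero    i≢j = ≡.refl
  𝟙-off-diagonal (suc i) (suc j) i≢j = 𝟙-off-diagonal i j (λ e → i≢j (≡.cong suc e))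

  lin-𝟙ʳ : ∀ {n} (l : Fin n) (u : Vector Carrierᴹ n) → lin (λ i → 𝟙 n i l) u ≈ᴹ u l
  lin-𝟙ʳ l u = ≈ᴹ-trans (lin-congʳ u (λ i → reflexive (𝟙-sym i l))) (lin-𝟙ˡ l u)

  sum-++ : ∀ m {n} (f : Vector Carrierᴹ (m ℕ.+ n)) →
           sum f ≈ᴹ sum (λ i → f (i ↑ˡ n)) +ᴹ sum (λ j → f (m ↑ʳ j))
  sum-++ ℕ.zero    f = ≈ᴹ-sym (+ᴹ-identityˡ _)
  sum-++ (ℕ.suc m) f = ≈ᴹ-trans (+ᴹ-congˡ (sum-++ m (λ i → f (suc i)))) (≈ᴹ-sym (+ᴹ-assoc _ _ _))

  -- Block tuples are later defined by cases on the sum type and pulled back along `splitAt`; this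
  -- separates the two blocks.
  lin-splitAt : ∀ m {n} (p : Fin m ⊎ Fin n → Carrier) (u : Fin m ⊎ Fin n → Carrierᴹ) →
                lin (λ l → p (splitAt m l)) (λ l → u (splitAt m l)) ≈ᴹ
                lin (λ i → p (inj₁ i)) (λ i → u (inj₁ i)) +ᴹ lin (λ j → p (inj₂ j)) (λ j → u (inj₂ j))
  lin-splitAt m {n} p u = ≈ᴹ-trans (sum-++ m {n} (λ l → p (splitAt m l) *ₗ u (splitAt m l)))
    (+ᴹ-cong (sum-cong-≋ λ i → ≈ᴹ-reflexive (≡.cong (λ s → p s *ₗ u s) (splitAt-↑ˡ m i n)))
             (sum-cong-≋ λ j → ≈ᴹ-reflexive (≡.cong (λ s → p s *ₗ u s) (splitAt-↑ʳ m n j))))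

-- Matrices acting on column vectors.

module MatrixProperties {c ℓ} (R : CommutativeRing c ℓ) where
  open CommutativeRing R hiding (zero)
  open Matrices R
  open Linear (⟨module⟩ {R = R})
  open Sum +-commutativeMonoid using (sum; sum-cong-≋; ∑-distrib-+)
  open RingProperties ring using (-1*x≈-x; -0#≈0#)

  private variable
    m n o p : ℕ

  -- Definitionally `lin (A i) q` in the regular module, which is how the lemmas on `lin` apply to
  -- matrices.
  mv : Matrix m n → Vector Carrier n → Vector Carrier m
  mv A q i = sum (λ j → A i j * q j)

  mv-congˡ : (A : Matrix m n) {p q : Vector Carrier n} → (∀ j → p j ≈ q j) → ∀ i → mv A p i ≈ mv A q i
  mv-congˡ A e i = lin-congˡ (A i) e

  mv-congʳ : {A B : Matrix m n} (q : Vector Carrier n) → A ≋ B → ∀ i → mv A q i ≈ mv B q i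
  mv-congʳ q e i = lin-congʳ q (e i)

  mv-⊠ : (A : Matrix m n) (B : Matrix n o) (q : Vector Carrier o) →
         ∀ i → mv (A ⊠ B) q i ≈ mv A (mv B q) i
  mv-⊠ A B q i = sym (lin-assoc (A i) B q)

  mv-𝟙 : (q : Vector Carrier n) → ∀ i → mv (𝟙 n) q i ≈ q i
  mv-𝟙 q i = lin-𝟙ˡ i q

  mv-col : (A : Matrix m n) (j : Fin n) → ∀ i → mv A (λ k → 𝟙 n k j) i ≈ A i j
  mv-col A j i = trans (sum-cong-≋ (λ k → *-comm (A i k) _)) (lin-𝟙ʳ j (A i))

  mv-+ : (A : Matrix m n) (p q : Vector Carrier n) → ∀ i → mv A (λ j → p j + q j) i ≈ mv A p i + mv A q i
  mv-+ A p q i = trans (sum-cong-≋ (λ j → distribˡ (A i j) (p j) (q j)))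
    (∑-distrib-+ (λ j → A i j * p j) (λ j → A i j * q j))

  mv-* : (A : Matrix m n) (r : Carrier) (q : Vector Carrier n) → ∀ i → mv A (λ j → r * q j) i ≈ r * mv A q i
  mv-* A r q i = sym (*ₗ-lin′ r (A i) q)

  mv-- : (A : Matrix m n) (p q : Vector Carrier n) → ∀ i → mv A (λ j → p j - q j) i ≈ mv A p i - mv A q i
  mv-- A p q i = begin
    mv A (λ j → p j - q j) i              ≈⟨ mv-+ A p (λ j → - q j) i ⟩
    mv A p i + mv A (λ j → - q j) i       ≈⟨ +-congˡ (mv-congˡ A (λ j → sym (-1*x≈-x (q j))) i) ⟩
    mv A p i + mv A (λ j → - 1# * q j) i  ≈⟨ +-congˡ (mv-* A (- 1#) q i) ⟩
    mv A p i + - 1# * mv A q i            ≈⟨ +-congˡ (-1*x≈-x _) ⟩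
    mv A p i - mv A q i                   ∎
    where open ≈-Reasoning setoid

  ⊠-congˡ : (A : Matrix m n) {B C : Matrix n o} → B ≋ C → A ⊠ B ≋ A ⊠ C
  ⊠-congˡ A e i k = mv-congˡ A (λ j → e j k) i

  ⊠-congʳ : {A B : Matrix m n} (C : Matrix n o) → A ≋ B → A ⊠ C ≋ B ⊠ C
  ⊠-congʳ C e i k = mv-congʳ (λ j → C j k) e i

  ⊠-assoc : (A : Matrix m n) (B : Matrix n o) (C : Matrix o p) → (A ⊠ B) ⊠ C ≋ A ⊠ (B ⊠ C)
  ⊠-assoc A B C i k = mv-⊠ A B (λ j → C j k) i

  ⊠-identityˡ : (A : Matrix m n) → 𝟙 m ⊠ A ≋ A
  ⊠-identityˡ A i k = mv-𝟙 (λ j → A j k) i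

  ⊠-identityʳ : (A : Matrix m n) → A ⊠ 𝟙 n ≋ A
  ⊠-identityʳ A i k = mv-col A k i

  ≋-sym : {A B : Matrix m n} → A ≋ B → B ≋ A
  ≋-sym e i j = sym (e i j)

  ≋-trans : {A B C : Matrix m n} → A ≋ B → B ≋ C → A ≋ C
  ≋-trans e f i j = trans (e i j) (f i j)

  Injective : Matrix m n → Set _
  Injective A = ∀ q → (∀ i → mv A q i ≈ 0#) → ∀ j → q j ≈ 0#

  Injective-≈ : {A : Matrix m n} → Injective A → ∀ p q → (∀ i → mv A p i ≈ mv A q i) → ∀ j → p j ≈ q j
  Injective-≈ {A = A} inj p q e j = -≈0⇒≈ᴹ (inj (λ j → p j - q j) (λ i → trans (mv-- A p q i) (≈ᴹ⇒-≈0 (e i))) j)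

  -- (1 − E)(1 + E) = 1 − E²
  unipotentˡ : {E : Matrix n n} → (∀ i j → (E ⊠ E) i j ≈ 0#) →
               (𝟙 n ⊟ E) ⊠ (λ i j → 𝟙 n i j + E i j) ≋ 𝟙 n
  unipotentˡ {n} {E} E²≈0 i k = begin
    ((𝟙 n ⊟ E) ⊠ H) i k                       ≈⟨ lin-- (𝟙 n i) (E i) (λ j → H j k) ⟩
    (𝟙 n ⊠ H) i k - (E ⊠ H) i k               ≈⟨ +-cong (⊠-identityˡ H i k) (-‿cong (mv-+ E (λ j → 𝟙 n j k) (λ j → E j k) i)) ⟩
    𝟙 n i k + E i k - ((E ⊠ 𝟙 n) i k + (E ⊠ E) i k)  ≈⟨ +-congˡ (-‿cong (trans (+-cong (⊠-identityʳ E i k) (E²≈0 i k)) (+-identityʳ _))) ⟩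
    𝟙 n i k + E i k - E i k                   ≈⟨ +-assoc _ _ _ ⟩
    𝟙 n i k + (E i k - E i k)                 ≈⟨ +-congˡ (-‿inverseʳ _) ⟩
    𝟙 n i k + 0#                              ≈⟨ +-identityʳ _ ⟩
    𝟙 n i k                                   ∎
    where
    open ≈-Reasoning setoid
    H : Matrix n n
    H i j = 𝟙 n i j + E i j

  unipotentʳ : {E : Matrix n n} → (∀ i j → (E ⊠ E) i j ≈ 0#) →
               (λ i j → 𝟙 n i j + E i j) ⊠ (𝟙 n ⊟ E) ≋ 𝟙 n
  unipotentʳ {n} {E} E²≈0 i k = begin
    ((λ i j → 𝟙 n i j + E i j) ⊠ G) i k       ≈⟨ lin-+ (𝟙 n i) (E i) (λ j → G j k) ⟩
    (𝟙 n ⊠ G) i k + (E ⊠ G) i k               ≈⟨ +-cong (⊠-identityˡ G i k) (mv-- E (λ j → 𝟙 n j k) (λ j → E j k) i) ⟩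
    𝟙 n i k - E i k + ((E ⊠ 𝟙 n) i k - (E ⊠ E) i k)  ≈⟨ +-congˡ (+-cong (⊠-identityʳ E i k) (trans (-‿cong (E²≈0 i k)) -0#≈0#)) ⟩
    𝟙 n i k - E i k + (E i k + 0#)            ≈⟨ +-congˡ (+-identityʳ _) ⟩
    𝟙 n i k - E i k + E i k                   ≈⟨ +-assoc _ _ _ ⟩
    𝟙 n i k + (- E i k + E i k)               ≈⟨ +-congˡ (-‿inverseˡ _) ⟩
    𝟙 n i k + 0#                              ≈⟨ +-identityʳ _ ⟩
    𝟙 n i k                                   ∎
    where
    open ≈-Reasoning setoid
    G : Matrix n n
    G = 𝟙 n ⊟ E

  diag : Vector Carrier n → Matrix n n
  diag {n} d i j = d i * 𝟙 n i j

  mv-diag : (d q : Vector Carrier n) → ∀ i → mv (diag d) q i ≈ d i * q i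
  mv-diag {n} d q i = trans (sum-cong-≋ (λ j → *-assoc (d i) (𝟙 n i j) (q j)))
    (trans (sym (*ₗ-distrib-sum (d i) (λ j → 𝟙 n i j * q j))) (*-congˡ (lin-𝟙ˡ i q)))

-- Relation matrices of tuples of module elements.

module Presentation {c ℓ m ℓm} {R : CommutativeRing c ℓ} (M : Module R m ℓm) where
  open CommutativeRing R hiding (zero)
  open Module M
  open Matrices R
  open Linear M
  open MatrixProperties R

  private variable
    n n′ : ℕ

  -- The tuple is treated as a row vector, so a change of generators is multiplication by a matrix
  -- on the right.
  _◃_ : Vector Carrierᴹ n → Matrix n n′ → Vector Carrierᴹ n′
  (u ◃ G) l = lin (λ i → G i l) u

  lin-mv : (u : Vector Carrierᴹ n) (G : Matrix n n′) (p : Vector Carrier n′) →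
           lin (mv G p) u ≈ᴹ lin p (u ◃ G)
  lin-mv u G p = ≈ᴹ-sym (≈ᴹ-trans (lin-assoc p (λ l i → G i l) u)
    (lin-congʳ u (λ i → Sum.sum-cong-≋ +-commutativeMonoid (λ l → *-comm (p l) (G i l)))))

  ◃-⊠ : (u : Vector Carrierᴹ n) (G : Matrix n n′) {o : ℕ} (H : Matrix n′ o) →
        ∀ l → (u ◃ (G ⊠ H)) l ≈ᴹ ((u ◃ G) ◃ H) l
  ◃-⊠ u G H l = lin-mv u G (λ j → H j l)

  -- Exactness in the middle of `R^n′ → R^n → M`, the maps being `A` and `u`. Whether `u` generates
  -- M is stated separately where it matters.
  record _Presents_ (A : Matrix n n′) (u : Vector Carrierᴹ n) : Set (c ⊔ ℓ ⊔ ℓm) where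
    field
      relation : ∀ q → lin (mv A q) u ≈ᴹ 0ᴹ
      solve    : ∀ p → lin p u ≈ᴹ 0ᴹ → ∃[ q ] (∀ i → mv A q i ≈ p i)

    column : ∀ j → lin (λ i → A i j) u ≈ᴹ 0ᴹ
    column j = ≈ᴹ-trans (lin-congʳ u (λ i → sym (mv-col A j i))) (relation _)

  open _Presents_

  -- G D and A are injective with the same image, so they factor through each other.
  presentations-equivalent :
    {A D : Matrix n n} {u w : Vector Carrierᴹ n} {G H : Matrix n n} →
    G ⊠ H ≋ 𝟙 n → H ⊠ G ≋ 𝟙 n → (∀ l → w l ≈ᴹ (u ◃ G) l) →
    A Presents u → Injective A → D Presents w → Injective D →
    ∃[ Q ] Invertible Q × H ⊠ A ⊠ Q ≋ D
  presentations-equivalent {n} {A} {D} {u} {w} {G} {H} GH HG w≈uG Au A-inj Dw D-inj =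
    Q , (S , QS≋𝟙 , SQ≋𝟙) , HAQ≋D
    where
    lin-w : ∀ p → lin p w ≈ᴹ lin (mv G p) u
    lin-w p = ≈ᴹ-trans (lin-congˡ p w≈uG) (≈ᴹ-sym (lin-mv u G p))

    column-of-Q : ∀ j → ∃[ q ] (∀ i → mv A q i ≈ (G ⊠ D) i j)
    column-of-Q j = solve Au (λ i → (G ⊠ D) i j) (≈ᴹ-trans (≈ᴹ-sym (lin-w (λ i → D i j))) (column Dw j))

    -- A relation p of `u` becomes the relation H p of `w = u G`, because G (H p) = p.
    column-of-S : ∀ j → ∃[ q ] (∀ i → mv D q i ≈ (H ⊠ A) i j)
    column-of-S j = solve Dw (λ i → (H ⊠ A) i j)
      (≈ᴹ-trans (lin-w _) (≈ᴹ-trans (lin-congʳ u GHA) (column Au j)))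
      where
      GHA : ∀ i → (G ⊠ (H ⊠ A)) i j ≈ A i j
      GHA i = trans (sym (⊠-assoc G H A i j)) (trans (⊠-congʳ A GH i j) (⊠-identityˡ A i j))

    Q S : Matrix n n
    Q i j = proj₁ (column-of-Q j) i
    S i j = proj₁ (column-of-S j) i

    AQ≋GD : A ⊠ Q ≋ G ⊠ D
    AQ≋GD i j = proj₂ (column-of-Q j) i

    DS≋HA : D ⊠ S ≋ H ⊠ A
    DS≋HA i j = proj₂ (column-of-S j) i

    HAQ≋D : H ⊠ A ⊠ Q ≋ D
    HAQ≋D = ≋-trans (⊠-assoc H A Q) (≋-trans (⊠-congˡ H AQ≋GD)
      (≋-trans (≋-sym (⊠-assoc H G D)) (≋-trans (⊠-congʳ D HG) (⊠-identityˡ D))))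

    -- Injectivity of `D` cancels it from D S Q = H A Q = D; the other product is treated likewise
    -- with `A`.
    SQ≋𝟙 : S ⊠ Q ≋ 𝟙 n
    SQ≋𝟙 j k = Injective-≈ D-inj _ _ (λ i → DSQ≋D i k) j
      where
      DSQ≋D : D ⊠ (S ⊠ Q) ≋ D ⊠ 𝟙 n
      DSQ≋D = ≋-trans (≋-sym (⊠-assoc D S Q)) (≋-trans (⊠-congʳ Q DS≋HA)
        (≋-trans HAQ≋D (≋-sym (⊠-identityʳ D))))

    QS≋𝟙 : Q ⊠ S ≋ 𝟙 n
    QS≋𝟙 j k = Injective-≈ A-inj _ _ (λ i → AQS≋A i k) j
      where
      AQS≋A : A ⊠ (Q ⊠ S) ≋ A ⊠ 𝟙 n
      AQS≋A = ≋-trans (≋-sym (⊠-assoc A Q S)) (≋-trans (⊠-congʳ S AQ≋GD)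
        (≋-trans (⊠-assoc G D S) (≋-trans (⊠-congˡ G DS≋HA)
        (≋-trans (≋-sym (⊠-assoc G H A)) (≋-trans (⊠-congʳ A GH)
        (≋-trans (⊠-identityˡ A) (≋-sym (⊠-identityʳ A))))))))

-- Degree bounds and division by monic polynomials.

module PolynomialProperties {c ℓ} (R : CommutativeRing c ℓ) where
  open CommutativeRing R hiding (zero)
  open Polynomials R
  open Sum +-commutativeMonoid using (sum; sum-cong-≋)
  open Sum (CommutativeRing.+-commutativeMonoid polyRing) using () renaming (sum to sumₚ; sum-cong-≋ to sumₚ-cong)
  open Linear (⟨module⟩ {R = R}) using (≈ᴹ⇒-≈0)
  open RingProperties ring using (-0#≈0#)

  -- A bound takes the place of the degree: a representing list may end in zeros, and over a general
  -- ring these cannot be detected.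
  Below : ℕ → Poly → Set ℓ
  Below n p = ∀ k → n ≤ k → coeff p k ≈ 0#

  IsMonic : ℕ → Poly → Set ℓ
  IsMonic n p = coeff p n ≈ 1# × Below (suc n) p

  Below-length : ∀ p → Below (length p) p
  Below-length []      k       _         = refl
  Below-length (a ∷ p) (suc k) (s≤s p≤k) = Below-length p k p≤k

  Below-≤ : ∀ {m n} p → m ≤ n → Below m p → Below n p
  Below-≤ p m≤n b k n≤k = b k (ℕ.≤-trans m≤n n≤k)

  Below-cong : ∀ {n p q} → p ≈ₚ q → Below n p → Below n q
  Below-cong e b k n≤k = trans (sym (at e k)) (b k n≤k)

  Below-zero : ∀ {p} → Below 0 p → p ≈ₚ 0ₚ
  Below-zero b .at k = b k z≤n

  Below-0 : ∀ n → Below n 0ₚ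
  Below-0 n k _ = refl

  coeff-- : ∀ p q k → coeff (p +ₚ -ₚ q) k ≈ coeff p k - coeff q k
  coeff-- p q k = trans (coeff-+ p (-ₚ q) k) (+-congˡ (coeff-neg q k))

  Below-- : ∀ {n} p q → Below n p → Below n q → Below n (p +ₚ -ₚ q)
  Below-- p q bp bq k n≤k =
    trans (coeff-- p q k) (≈ᴹ⇒-≈0 (trans (bp k n≤k) (sym (bq k n≤k))))

  Below-const : ∀ a → Below 1 (const a)
  Below-const a (suc k) _ = refl

  IsMonic-cong : ∀ {n p q} → p ≈ₚ q → IsMonic n p → IsMonic n q
  IsMonic-cong {n} e (lead , below) = trans (sym (at e n)) lead , Below-cong e below

  coeff-∷-* : ∀ a p q k → coeff ((a ∷ p) *ₚ q) (suc k) ≈ a * coeff q (suc k) + coeff (p *ₚ q) k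
  coeff-∷-* a p q k = trans (coeff-+ (a · q) (0# ∷ p *ₚ q) (suc k)) (+-congʳ (coeff-· a q (suc k)))

  -- The bounds mean deg p < i and deg q ≤ j. Mixing a strict with a weak bound gives deg (p q) < i
  -- + j without subtracting 1.
  Below-* : ∀ {i j} p q → Below i p → Below (suc j) q → Below (i ℕ.+ j) (p *ₚ q)
  Below-* {zero}      p       q bp bq k       _         = at (*ₚ-zeroˡ p q (Below-zero bp)) k
  Below-* {suc i}     []      q bp bq k       _         = refl
  Below-* {suc i} {j} (a ∷ p) q bp bq (suc k) (s≤s i+j≤k) = begin
    coeff ((a ∷ p) *ₚ q) (suc k)                ≈⟨ coeff-∷-* a p q k ⟩
    a * coeff q (suc k) + coeff (p *ₚ q) k      ≈⟨ +-cong (*-congˡ (bq (suc k) (s≤s (ℕ.m+n≤o⇒n≤o i i+j≤k))))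
                                                         (Below-* p q (λ l i≤l → bp (suc l) (s≤s i≤l)) bq k i+j≤k) ⟩
    a * 0# + 0#                                 ≈⟨ trans (+-identityʳ _) (zeroʳ a) ⟩
    0#                                          ∎
    where open ≈-Reasoning setoid

  coeff-*-top : ∀ {i j} p q → Below (suc i) p → Below (suc j) q →
                coeff (p *ₚ q) (i ℕ.+ j) ≈ coeff p i * coeff q j
  coeff-*-top         []      q bp bq = sym (zeroˡ _)
  coeff-*-top {zero}  {j} (a ∷ p) q bp bq = begin
    coeff (a · q +ₚ (0# ∷ p *ₚ q)) j            ≈⟨ coeff-+ (a · q) (0# ∷ p *ₚ q) j ⟩
    coeff (a · q) j + coeff (0# ∷ p *ₚ q) j     ≈⟨ +-cong (coeff-· a q j) (at (0∷0≈0 (*ₚ-zeroˡ p q p≈0)) j) ⟩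
    a * coeff q j + 0#                          ≈⟨ +-identityʳ _ ⟩
    a * coeff q j                               ∎
    where
    open ≈-Reasoning setoid
    p≈0 : p ≈ₚ 0ₚ
    p≈0 .at k = bp (suc k) (s≤s z≤n)
  coeff-*-top {suc i} {j} (a ∷ p) q bp bq = begin
    coeff ((a ∷ p) *ₚ q) (suc (i ℕ.+ j))                          ≈⟨ coeff-∷-* a p q (i ℕ.+ j) ⟩
    a * coeff q (suc (i ℕ.+ j)) + coeff (p *ₚ q) (i ℕ.+ j)        ≈⟨ +-cong (*-congˡ (bq _ (s≤s (ℕ.m≤n+m j i))))
                                                                      (coeff-*-top p q (λ l i≤l → bp (suc l) (s≤s i≤l)) bq) ⟩
    a * 0# + coeff p i * coeff q j                                ≈⟨ +-congʳ (zeroʳ a) ⟩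
    0# + coeff p i * coeff q j                                    ≈⟨ +-identityˡ _ ⟩
    coeff p i * coeff q j                                         ∎
    where open ≈-Reasoning setoid

  IsMonic-1 : IsMonic 0 1ₚ
  IsMonic-1 = refl , Below-const 1#

  IsMonic-* : ∀ {i j} p q → IsMonic i p → IsMonic j q → IsMonic (i ℕ.+ j) (p *ₚ q)
  IsMonic-* p q (lp , bp) (lq , bq) =
    trans (coeff-*-top p q bp bq) (trans (*-cong lp lq) (*-identityˡ 1#)) , Below-* p q bp bq

  IsMonic-- : ∀ {n} p q → IsMonic n p → Below n q → IsMonic n (p +ₚ -ₚ q)
  IsMonic-- {n} p q (lp , bp) bq = lead , Below-- p q bp (Below-≤ q (ℕ.n≤1+n n) bq)
    where
    open ≈-Reasoning setoid
    lead : coeff (p +ₚ -ₚ q) n ≈ 1#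
    lead = begin
      coeff (p +ₚ -ₚ q) n    ≈⟨ coeff-- p q n ⟩
      coeff p n - coeff q n  ≈⟨ +-cong lp (-‿cong (bq n ℕ.≤-refl)) ⟩
      1# - 0#                ≈⟨ +-congˡ -0#≈0# ⟩
      1# + 0#                ≈⟨ +-identityʳ 1# ⟩
      1#                     ∎

  -- The bound on q is lowered one step at a time, starting from its length: if q has degree at most
  -- k, then its coefficient at k equals that of q a at k + n, which vanishes. No degree of q has to
  -- be determined.
  monic-∣-below : ∀ {n a r} q → IsMonic n a → q *ₚ a ≈ₚ r → Below n r → q ≈ₚ 0ₚ
  monic-∣-below {n} {a} {r} q (lead , below) qa≈r r-below = descend (length q) (Below-length q)
    where
    open ≈-Reasoning setoid
    descend : ∀ k → Below k q → q ≈ₚ 0ₚ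
    descend zero    b = Below-zero b
    descend (suc k) b = descend k b′
      where
      top : coeff q k ≈ 0#
      top = begin
        coeff q k                 ≈⟨ *-identityʳ _ ⟨
        coeff q k * 1#            ≈⟨ *-congˡ lead ⟨
        coeff q k * coeff a n     ≈⟨ coeff-*-top q a b below ⟨
        coeff (q *ₚ a) (k ℕ.+ n)  ≈⟨ at qa≈r (k ℕ.+ n) ⟩
        coeff r (k ℕ.+ n)         ≈⟨ r-below (k ℕ.+ n) (ℕ.m≤n+m n k) ⟩
        0#                        ∎
      b′ : Below k q
      b′ l k≤l with ℕ.m≤n⇒m<n∨m≡n k≤l
      ... | inj₁ k<l    = b l k<l
      ... | inj₂ ≡.refl = top

  truncate : ∀ n → Poly → Vector Carrier n
  truncate n p j = coeff p (toℕ j)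

  tabulate-truncate : ∀ {n} p → Below n p → tabulate (truncate n p) ≈ₚ p
  tabulate-truncate {zero}  p       b = ≈ₚ-sym (Below-zero b)
  tabulate-truncate {suc n} []      b = 0∷0≈0 (tabulate-truncate {n} [] (Below-0 n))
  tabulate-truncate {suc n} (a ∷ p) b = ∷-cong refl (tabulate-truncate p (λ k n≤k → b (suc k) (s≤s n≤k)))

  Below-tabulate : ∀ {n} (f : Vector Carrier n) → Below n (tabulate f)
  Below-tabulate {zero}  f k       _         = refl
  Below-tabulate {suc n} f (suc k) (s≤s n≤k) = Below-tabulate (λ i → f (suc i)) k n≤k

  tabulate≈0 : ∀ {n} (f : Vector Carrier n) → tabulate f ≈ₚ 0ₚ → ∀ i → f i ≈ 0#
  tabulate≈0 f e zero    = at e 0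
  tabulate≈0 f e (suc i) = tabulate≈0 (λ i → f (suc i)) (tail≈0 e) i

  -- Recursion on p = b + x p′: if p′ leaves the remainder r, then t a is subtracted from b + x r,
  -- with t its coefficient at n. The remainder is returned as a vector of exactly n coefficients
  -- because these become coordinates in the adapted basis.
  divide : ∀ {n a} → IsMonic n a → ∀ p → ∃[ q ] ∃[ f ] p ≈ₚ q *ₚ a +ₚ tabulate {n = n} f
  divide {n} {a} monic p = let q , r , b , e = go p in
    q , truncate n r , ≈ₚ-trans e (+ₚ-cong {q *ₚ a} ≈ₚ-refl (≈ₚ-sym (tabulate-truncate r b)))
    where
    go : ∀ p → ∃[ q ] ∃[ r ] Below n r × p ≈ₚ q *ₚ a +ₚ r
    go []      = [] , [] , Below-0 n , ≈ₚ-refl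
    go (b ∷ p) = let q , r , r-below , e = go p
                     s = b ∷ r
                     t = coeff s n
                 in (t ∷ q) , s +ₚ -ₚ (t · a) , below s (s-below r r-below) , quot q r e t
      where
      s-below : ∀ r → Below n r → Below (suc n) (b ∷ r)
      s-below r r-below (suc k) (s≤s n≤k) = r-below k n≤k

      below : ∀ s → Below (suc n) s → Below n (s +ₚ -ₚ (coeff s n · a))
      below s b k n≤k = trans (coeff-- s (coeff s n · a) k)
        (≈ᴹ⇒-≈0 (trans (lemma (ℕ.m≤n⇒m<n∨m≡n n≤k)) (sym (coeff-· (coeff s n) a k))))
        where
        lemma : _ → coeff s k ≈ coeff s n * coeff a k
        lemma (inj₁ n<k)    = trans (b k n<k) (trans (sym (zeroʳ _)) (*-congˡ (sym (proj₂ monic k n<k))))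
        lemma (inj₂ ≡.refl) = trans (sym (*-identityʳ _)) (*-congˡ (sym (proj₁ monic)))

      open ≈-Reasoning (CommutativeRing.setoid polyRing)
      quot : ∀ q r → p ≈ₚ q *ₚ a +ₚ r → ∀ t → b ∷ p ≈ₚ (t ∷ q) *ₚ a +ₚ ((b ∷ r) +ₚ -ₚ (t · a))
      quot q r e t = begin
        b ∷ p                                       ≈⟨ ∷-cong (sym (+-identityˡ b)) e ⟩
        (0# ∷ q *ₚ a) +ₚ (b ∷ r)                    ≈⟨ xy∙z-x≈yz (t · a) (0# ∷ q *ₚ a) (b ∷ r) ⟨
        (t ∷ q) *ₚ a +ₚ ((b ∷ r) +ₚ -ₚ (t · a))     ∎
        where
        xy∙z-x≈yz : ∀ x y z → (x +ₚ y) +ₚ (z +ₚ -ₚ x) ≈ₚ y +ₚ z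
        xy∙z-x≈yz x y z = begin
          (x +ₚ y) +ₚ (z +ₚ -ₚ x)   ≈⟨ +ₚ-cong (+ₚ-comm x y) (+ₚ-comm z (-ₚ x)) ⟩
          (y +ₚ x) +ₚ (-ₚ x +ₚ z)   ≈⟨ +ₚ-assoc y x (-ₚ x +ₚ z) ⟩
          y +ₚ (x +ₚ (-ₚ x +ₚ z))   ≈⟨ +ₚ-cong {y} ≈ₚ-refl (+ₚ-assoc x (-ₚ x) z) ⟨
          y +ₚ ((x +ₚ -ₚ x) +ₚ z)   ≈⟨ +ₚ-cong {y} ≈ₚ-refl (+ₚ-cong {q = z} (-ₚ-inverseʳ x) ≈ₚ-refl) ⟩
          y +ₚ z                    ∎

  const-0 : const 0# ≈ₚ 0ₚ
  const-0 = 0∷0≈0 ≈ₚ-refl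

  const-cong : ∀ {a b} → a ≈ b → const a ≈ₚ const b
  const-cong e = ∷-cong e ≈ₚ-refl

  const-* : ∀ a b → const (a * b) ≈ₚ const a *ₚ const b
  const-* a b = const-cong (sym (+-identityʳ (a * b)))

  const-sum : ∀ {n} (f : Vector Carrier n) → const (sum f) ≈ₚ sumₚ (λ i → const (f i))
  const-sum {zero}  f = const-0
  const-sum {suc n} f = +ₚ-cong {const (f zero)} ≈ₚ-refl (const-sum (λ i → f (suc i)))

  const-sum-* : ∀ {n} (f g : Vector Carrier n) →
                const (sum (λ i → f i * g i)) ≈ₚ sumₚ (λ i → const (f i) *ₚ const (g i))
  const-sum-* f g = ≈ₚ-trans (const-sum (λ i → f i * g i)) (sumₚ-cong (λ i → const-* (f i) (g i)))

  coeff-sum : ∀ {n} (f : Vector Poly n) k → coeff (sumₚ f) k ≈ sum (λ i → coeff (f i) k)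
  coeff-sum {zero}  f k = refl
  coeff-sum {suc n} f k = trans (coeff-+ (f zero) _ k) (+-congˡ (coeff-sum (λ i → f (suc i)) k))

  const*≈· : ∀ a p → const a *ₚ p ≈ₚ a · p
  const*≈· a p = ≈ₚ-trans (+ₚ-cong {a · p} ≈ₚ-refl (0∷0≈0 ≈ₚ-refl)) (+ₚ-identityʳ (a · p))

  X*≈0∷ : ∀ p → X *ₚ p ≈ₚ 0# ∷ p
  X*≈0∷ p = ≈ₚ-trans (0∷-*ₚ 1ₚ p) (∷-cong refl (*ₚ-identityˡ p))

  X^ : ℕ → Poly
  X^ zero    = 1ₚ
  X^ (suc n) = 0# ∷ X^ n

  nonConstant-degree : ∀ {p} → Monic p → ¬ Constant p → ∃[ n ] IsMonic (suc n) p
  nonConstant-degree (suc n , p-monic) _ = n , p-monic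
  nonConstant-degree {p} (zero , lead , below) nonConstant = contradiction (_ , p≈1) nonConstant
    where
    p≈1 : p ≈ₚ const 1#
    p≈1 .at zero    = lead
    p≈1 .at (suc k) = below (suc k) (s≤s z≤n)

-- A monic annihilator by cross-multiplication.

module MonicAnnihilator {c ℓ m ℓm} {R : CommutativeRing c ℓ}
                        (N : Module (Polynomials.polyRing R) m ℓm) where
  open Polynomials R
  open PolynomialProperties R
  open Module N
  open Matrices polyRing using (Matrix)
  open Linear N
  open AbelianGroupProperties +ᴹ-abelianGroup using ()
    renaming (inverseʳ-unique to inverseʳ-uniqueᴹ)
  open ≈-Reasoning ≈ᴹ-setoid

  -- Cross-multiplying with the first equation eliminates the first unknown and
  -- doubles the degree of the diagonal, which still dominates.
  monic-annihilator : ∀ {n} d (b : Matrix n n) (u : Vector Carrierᴹ n) →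
    (∀ i → IsMonic (suc d) (b i i)) → (∀ i j → i ≢ j → Below (suc d) (b i j)) →
    (∀ i → lin (b i) u ≈ᴹ 0ᴹ) → ∃[ p ] Monic p × (∀ j → p *ₗ u j ≈ᴹ 0ᴹ)
  monic-annihilator {zero}  d b u monic below equation = 1ₚ , (0 , IsMonic-1) , λ ()
  monic-annihilator {suc n} d b u monic below equation =
    p *ₚ b₀₀ , (_ , IsMonic-* p b₀₀ (proj₂ p-monic) (monic zero)) , kills
    where
    b₀₀ : Poly
    b₀₀ = b zero zero

    u′ : Vector Carrierᴹ n
    u′ j = u (suc j)

    b′ : Matrix n n
    b′ i j = b (suc i) (suc j) *ₚ b₀₀ +ₚ -ₚ (b (suc i) zero *ₚ b zero (suc j))

    cross-below : ∀ i j → Below (suc d ℕ.+ suc d) (b (suc i) zero *ₚ b zero (suc j))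
    cross-below i j = Below-≤ (b (suc i) zero *ₚ b zero (suc j)) (ℕ.+-monoʳ-≤ (suc d) (ℕ.n≤1+n d))
      (Below-* (b (suc i) zero) (b zero (suc j)) (below (suc i) zero λ ()) (below zero (suc j) λ ()))

    monic′ : ∀ i → IsMonic (suc d ℕ.+ suc d) (b′ i i)
    monic′ i = IsMonic-- (b (suc i) (suc i) *ₚ b₀₀) (b (suc i) zero *ₚ b zero (suc i))
      (IsMonic-* (b (suc i) (suc i)) b₀₀ (monic (suc i)) (monic zero)) (cross-below i i)

    below′ : ∀ i j → i ≢ j → Below (suc d ℕ.+ suc d) (b′ i j)
    below′ i j i≢j = Below-- (b (suc i) (suc j) *ₚ b₀₀) (b (suc i) zero *ₚ b zero (suc j))
      (Below-* (b (suc i) (suc j)) b₀₀ (below (suc i) (suc j) λ e → i≢j (suc-injective e)) (proj₂ (monic zero)))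
      (cross-below i j)

    tail-equation : ∀ i → lin (λ j → b i (suc j)) u′ ≈ᴹ -ᴹ (b i zero *ₗ u zero)
    tail-equation i = inverseʳ-uniqueᴹ _ _ (equation i)

    scaled : ∀ r i → lin (λ j → r *ₚ b i (suc j)) u′ ≈ᴹ -ᴹ ((r *ₚ b i zero) *ₗ u zero)
    scaled r i = begin
      lin (λ j → r *ₚ b i (suc j)) u′       ≈⟨ *ₗ-lin r (λ j → b i (suc j)) u′ ⟨
      r *ₗ lin (λ j → b i (suc j)) u′       ≈⟨ *ₗ-congˡ (tail-equation i) ⟩
      r *ₗ -ᴹ (b i zero *ₗ u zero)          ≈⟨ *ₗ-congˡ (-‿*ₗ (b i zero) (u zero)) ⟨
      r *ₗ (-ₚ b i zero) *ₗ u zero          ≈⟨ *ₗ-assoc r (-ₚ b i zero) (u zero) ⟨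
      (r *ₚ -ₚ b i zero) *ₗ u zero          ≈⟨ *ₗ-congʳ (*ₚ-comm r (-ₚ b i zero)) ⟩
      (-ₚ b i zero *ₚ r) *ₗ u zero          ≈⟨ *ₗ-assoc (-ₚ b i zero) r (u zero) ⟩
      (-ₚ b i zero) *ₗ r *ₗ u zero          ≈⟨ -‿*ₗ (b i zero) (r *ₗ u zero) ⟩
      -ᴹ (b i zero *ₗ r *ₗ u zero)          ≈⟨ -ᴹ‿cong (*ₗ-assoc (b i zero) r (u zero)) ⟨
      -ᴹ ((b i zero *ₚ r) *ₗ u zero)        ≈⟨ -ᴹ‿cong (*ₗ-congʳ (*ₚ-comm (b i zero) r)) ⟩
      -ᴹ ((r *ₚ b i zero) *ₗ u zero)        ∎

    equation′ : ∀ i → lin (b′ i) u′ ≈ᴹ 0ᴹ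
    equation′ i = ≈ᴹ-trans (lin-- (λ j → b (suc i) (suc j) *ₚ b₀₀) (λ j → b (suc i) zero *ₚ b zero (suc j)) u′)
      (≈ᴹ⇒-≈0 (begin
      lin (λ j → b (suc i) (suc j) *ₚ b₀₀) u′           ≈⟨ lin-congʳ u′ (λ j → *ₚ-comm (b (suc i) (suc j)) b₀₀) ⟩
      lin (λ j → b₀₀ *ₚ b (suc i) (suc j)) u′           ≈⟨ scaled b₀₀ (suc i) ⟩
      -ᴹ ((b₀₀ *ₚ b (suc i) zero) *ₗ u zero)            ≈⟨ -ᴹ‿cong (*ₗ-congʳ (*ₚ-comm b₀₀ (b (suc i) zero))) ⟩
      -ᴹ ((b (suc i) zero *ₚ b₀₀) *ₗ u zero)            ≈⟨ scaled (b (suc i) zero) zero ⟨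
      lin (λ j → b (suc i) zero *ₚ b zero (suc j)) u′   ∎))

    smaller : ∃[ p ] Monic p × (∀ j → p *ₗ u′ j ≈ᴹ 0ᴹ)
    -- The new diagonal degree `suc d + suc d` is `suc (d + suc d)`.
    smaller = monic-annihilator (d ℕ.+ suc d) b′ u′ monic′ below′ equation′

    p : Poly
    p = proj₁ smaller

    p-monic : Monic p
    p-monic = proj₁ (proj₂ smaller)

    p-kills : ∀ j → p *ₗ u′ j ≈ᴹ 0ᴹ
    p-kills = proj₂ (proj₂ smaller)

    kills : ∀ j → (p *ₚ b₀₀) *ₗ u j ≈ᴹ 0ᴹ
    kills (suc j) = begin
      (p *ₚ b₀₀) *ₗ u′ j    ≈⟨ *ₗ-congʳ (*ₚ-comm p b₀₀) ⟩
      (b₀₀ *ₚ p) *ₗ u′ j    ≈⟨ *ₗ-assoc b₀₀ p (u′ j) ⟩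
      b₀₀ *ₗ p *ₗ u′ j      ≈⟨ *ₗ-congˡ (p-kills j) ⟩
      b₀₀ *ₗ 0ᴹ             ≈⟨ *ₗ-zeroʳ b₀₀ ⟩
      0ᴹ                    ∎
    -- By the first equation b₀₀ u₀ is a combination of the remaining unknowns, all of which p
    -- kills.
    kills zero = begin
      (p *ₚ b₀₀) *ₗ u zero                    ≈⟨ *ₗ-assoc p b₀₀ (u zero) ⟩
      p *ₗ b₀₀ *ₗ u zero                      ≈⟨ *ₗ-congˡ (inverseʳ-uniqueᴹ _ _ (≈ᴹ-trans (+ᴹ-comm _ _) (equation zero))) ⟩
      p *ₗ -ᴹ lin (λ j → b zero (suc j)) u′   ≈⟨ *ₗ-congˡ (lin-neg (λ j → b zero (suc j)) u′) ⟨
      p *ₗ lin (λ j → -ₚ b zero (suc j)) u′   ≈⟨ *ₗ-lin′ p (λ j → -ₚ b zero (suc j)) u′ ⟩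
      lin (λ j → -ₚ b zero (suc j)) (λ j → p *ₗ u′ j)  ≈⟨ lin-zeroʳ (λ j → -ₚ b zero (suc j)) p-kills ⟩
      0ᴹ                                      ∎

-- Polynomials acting through φ.

module PolynomialAction {c ℓ m ℓm} {R : CommutativeRing c ℓ} (M : Module R m ℓm) (φ : Modules.End M) where
  open CommutativeRing R hiding (zero)
  open Polynomials R
  open PolynomialProperties R
  open Module M
  open Modules.End φ using (fun; ⟦⟧-cong; +ᴹ-homo; 0ᴹ-homo; *ₗ-homo)
  open ≈-Reasoning ≈ᴹ-setoid
  module L = Linear M
  module Lₚ = Linear (polyModule M φ)

  act-const : ∀ a v → act M φ (const a) v ≈ᴹ a *ₗ v
  act-const a v = ≈ᴹ-trans (+ᴹ-congˡ 0ᴹ-homo) (+ᴹ-identityʳ _)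

  act-0∷ : ∀ p v → act M φ (0# ∷ p) v ≈ᴹ fun (act M φ p v)
  act-0∷ p v = ≈ᴹ-trans (+ᴹ-congʳ (*ₗ-zeroˡ v)) (+ᴹ-identityˡ _)

  lin-const : ∀ {k} (r : Vector Carrier k) u → Lₚ.lin (λ i → const (r i)) u ≈ᴹ L.lin r u
  lin-const r u = Sum.sum-cong-≋ +ᴹ-commutativeMonoid (λ i → act-const (r i) (u i))

  fun-lin : ∀ {k} (p : Vector Carrier k) u → fun (L.lin p u) ≈ᴹ L.lin p (λ i → fun (u i))
  fun-lin {zero}  p u = 0ᴹ-homo
  fun-lin {suc k} p u = ≈ᴹ-trans (+ᴹ-homo _ _)
    (+ᴹ-cong (*ₗ-homo (p zero) (u zero)) (fun-lin (λ i → p (suc i)) (λ i → u (suc i))))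

  -- Horner's rule unrolled. It converts polynomial multiples of v into linear combinations, over
  -- the base ring, of the x^j v.
  act-tabulate : ∀ {k} (f : Vector Carrier k) v →
                 act M φ (tabulate f) v ≈ᴹ L.lin f (λ j → act M φ (X^ (toℕ j)) v)
  act-tabulate {zero}  f v = ≈ᴹ-refl
  act-tabulate {suc k} f v = +ᴹ-cong (*ₗ-congˡ (≈ᴹ-sym (act-identityˡ M φ v))) (begin
    fun (act M φ (tabulate f′) v)                      ≈⟨ ⟦⟧-cong (act-tabulate f′ v) ⟩
    fun (L.lin f′ (λ j → act M φ (X^ (toℕ j)) v))      ≈⟨ fun-lin f′ (λ j → act M φ (X^ (toℕ j)) v) ⟩
    L.lin f′ (λ j → fun (act M φ (X^ (toℕ j)) v))      ≈⟨ L.lin-congˡ f′ (λ j → act-0∷ (X^ (toℕ j)) v) ⟨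
    L.lin f′ (λ j → act M φ (X^ (suc (toℕ j))) v)      ∎)
    where
    f′ : Vector Carrier k
    f′ j = f (suc j)

-- One step of the division by x − C: if t = m + r then x t + b = (x m + (x r − c)) + (c + b).
shift-remainder : ∀ {c ℓ} (R : CommutativeRing c ℓ) → let open CommutativeRing R in
  ∀ x m r c b {p t s s₁ s₂} → p ≈ x * t + b → t ≈ m + r →
  s ≈ s₁ + s₂ → s₁ ≈ x * m → s₂ ≈ x * r - c → p ≈ s + (c + b)
shift-remainder R x m r c b {p} {t} {s} {s₁} {s₂} p≈ t≈ s≈ s₁≈ s₂≈ = begin
  p                                  ≈⟨ p≈ ⟩
  x * t + b                          ≈⟨ +-congʳ (trans (*-congˡ t≈) (distribˡ x m r)) ⟩
  x * m + x * r + b                  ≈⟨ +-congʳ (+-congˡ (+-identityʳ _)) ⟨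
  x * m + (x * r + 0#) + b           ≈⟨ +-congʳ (+-congˡ (+-congˡ (-‿inverseˡ c))) ⟨
  x * m + (x * r + (- c + c)) + b    ≈⟨ +-congʳ (+-congˡ (+-assoc _ _ _)) ⟨
  x * m + (x * r - c + c) + b        ≈⟨ +-congʳ (+-assoc _ _ _) ⟨
  x * m + (x * r - c) + c + b        ≈⟨ +-assoc _ _ _ ⟩
  x * m + (x * r - c) + (c + b)      ≈⟨ +-congʳ (trans s≈ (+-cong s₁≈ s₂≈)) ⟨
  s + (c + b)                        ∎
  where
  open CommutativeRing R
  open ≈-Reasoning setoid

-- The characteristic matrix as relation matrix of a basis.

module Characteristic {c ℓ m ℓm} {R : CommutativeRing c ℓ} (M : Module R m ℓm) (φ : Modules.End M)
                      {n : ℕ} {β : Vector (Module.Carrierᴹ M) n} (β-isBasis : Modules.IsBasis M β) where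
  open CommutativeRing R hiding (zero)
  open Polynomials R
  open PolynomialProperties R
  open Module M
  open Modules M using (matrixOf)
  open Modules.IsBasis β-isBasis
  open Modules.End φ using (fun; ⟦⟧-cong)
  open Sum +-commutativeMonoid using (sum; sum-cong-≋)
  open PolynomialAction M φ
  module Poly = Linear (⟨module⟩ {R = polyRing})
  open MatrixProperties R using () renaming (mv to mvᴿ)
  open MatrixProperties polyRing
  open Matrices polyRing using (Matrix; 𝟙)
  open Presentation (polyModule M φ)

  C : Matrices.Matrix R n n
  C = matrixOf β-isBasis φ

  Cₚ : Matrix n n
  Cₚ i j = const (C i j)

  A : Matrix n n
  A = characteristicMatrix R C

  mv-A : ∀ q i → mv A q i ≈ₚ X *ₚ q i +ₚ -ₚ mv Cₚ q i
  mv-A q i = ≈ₚ-trans (Poly.lin-- (λ j → X *ₚ 𝟙 n i j) (Cₚ i) q)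
    (+ₚ-cong (≈ₚ-trans (≈ₚ-sym (Poly.*ₗ-lin X (𝟙 n i) q)) (*ₚ-cong {X} ≈ₚ-refl (Poly.lin-𝟙ˡ i q))) ≈ₚ-refl)

  -- Column j of `C` holds the coordinates of φ(βⱼ), and `X` acts as φ.
  ◃A≈0 : ∀ j → (β ◃ A) j ≈ᴹ 0ᴹ
  ◃A≈0 j = ≈ᴹ-trans (Lₚ.lin-- (λ i → X *ₚ 𝟙 n i j) (λ i → Cₚ i j) β) (L.≈ᴹ⇒-≈0 (begin
    Lₚ.lin (λ i → X *ₚ 𝟙 n i j) β         ≈⟨ Lₚ.*ₗ-lin X (λ i → 𝟙 n i j) β ⟨
    act M φ X (Lₚ.lin (λ i → 𝟙 n i j) β)  ≈⟨ act-cong M φ X X ≈ₚ-refl (Lₚ.lin-𝟙ʳ j β) ⟩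
    act M φ X (β j)                       ≈⟨ act-0∷ 1ₚ (β j) ⟩
    fun (act M φ 1ₚ (β j))                ≈⟨ ⟦⟧-cong (act-identityˡ M φ (β j)) ⟩
    fun (β j)                             ≈⟨ proj₂ (spanning (fun (β j))) ⟨
    L.lin (λ i → C i j) β                 ≈⟨ lin-const (λ i → C i j) β ⟨
    Lₚ.lin (λ i → Cₚ i j) β               ∎))
    where open ≈-Reasoning ≈ᴹ-setoid

  β-annihilated : ∃[ p ] Monic p × (∀ j → act M φ p (β j) ≈ᴹ 0ᴹ)
  -- Relations are columns of `A`, whereas the elimination reads rows, hence the transpose. The
  -- diagonal has degree 1, hence the 0.
  β-annihilated = MonicAnnihilator.monic-annihilator (polyModule M φ) 0 (λ i j → A j i) β
    diagonal (λ i j i≢j → off-diagonal j i (λ j≡i → i≢j (≡.sym j≡i))) ◃A≈0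
    where
    X-monic : IsMonic 1 X
    X-monic = refl , below
      where
      below : Below 2 X
      below (suc zero)    (s≤s ())
      below (suc (suc k)) _ = refl

    diagonal : ∀ i → IsMonic 1 (A i i)
    diagonal i = IsMonic-- (X *ₚ 𝟙 n i i) (Cₚ i i)
      (IsMonic-cong (≈ₚ-sym (≡.subst (λ δ → X *ₚ δ ≈ₚ X) (≡.sym (Poly.𝟙-diagonal i)) (*ₚ-identityʳ X))) X-monic)
      (Below-const (C i i))

    off-diagonal : ∀ i j → i ≢ j → Below 1 (A i j)
    off-diagonal i j i≢j = Below-- (X *ₚ 𝟙 n i j) (Cₚ i j)
      (Below-cong (≈ₚ-sym (≡.subst (λ δ → X *ₚ δ ≈ₚ 0ₚ) (≡.sym (Poly.𝟙-off-diagonal i j i≢j)) (*ₚ-zeroʳ X))) (Below-0 1))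
      (Below-const (C i j))

  common-bound : ∀ {k} (q : Vector Poly k) → ∃[ K ] (∀ i → Below K (q i))
  common-bound {zero}  q = 0 , λ ()
  common-bound {suc k} q with common-bound (λ i → q (suc i))
  ... | K , below = length (q zero) ℕ.⊔ K , λ where
    zero    → Below-≤ (q zero) (ℕ.m≤m⊔n _ K) (Below-length (q zero))
    (suc i) → Below-≤ (q (suc i)) (ℕ.m≤n⊔m (length (q zero)) K) (below i)

  -- A q = 0 means x q = C q, so the coefficient vectors satisfy q_k = C q_(k+1); vanishing descends
  -- from a common degree bound.
  A-injective : Injective A
  A-injective q Aq≈0 = let K , below = common-bound q in descend K below
    where
    open ≈-Reasoning setoid
    Xq≈Cq : ∀ i → X *ₚ q i ≈ₚ mv Cₚ q i
    Xq≈Cq i = Poly.-≈0⇒≈ᴹ (≈ₚ-trans (≈ₚ-sym (mv-A q i)) (Aq≈0 i))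

    shift : ∀ k i → coeff (q i) k ≈ sum (λ j → C i j * coeff (q j) (suc k))
    shift k i = begin
      coeff (q i) k                               ≈⟨ at (X*≈0∷ (q i)) (suc k) ⟨
      coeff (X *ₚ q i) (suc k)                    ≈⟨ at (Xq≈Cq i) (suc k) ⟩
      coeff (mv Cₚ q i) (suc k)                   ≈⟨ coeff-sum (λ j → Cₚ i j *ₚ q j) (suc k) ⟩
      sum (λ j → coeff (Cₚ i j *ₚ q j) (suc k))
        ≈⟨ sum-cong-≋ (λ j → trans (at (const*≈· (C i j) (q j)) (suc k)) (coeff-· (C i j) (q j) (suc k))) ⟩
      sum (λ j → C i j * coeff (q j) (suc k))     ∎

    descend : ∀ K → (∀ i → Below K (q i)) → ∀ i → q i ≈ₚ 0ₚ
    descend zero    below i = Below-zero (below i)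
    descend (suc K) below   = descend K below′
      where
      below′ : ∀ i → Below K (q i)
      below′ i k K≤k = trans (shift k i)
        (Linear.lin-zeroʳ (⟨module⟩ {R = R}) (C i) (λ j → below j (suc k) (s≤s K≤k)))

  Remainder : Vector Poly n → Set _
  Remainder p = ∃[ q ] Σ[ r ∈ Vector Carrier n ] (∀ i → p i ≈ₚ mv A q i +ₚ const (r i))

  remainder : ∀ p → Remainder p
  remainder p = let K , below = common-bound p in go K p below
    where
    tailₚ : Poly → Poly
    tailₚ []      = []
    tailₚ (_ ∷ p) = p

    uncons : ∀ p → p ≈ₚ X *ₚ tailₚ p +ₚ const (coeff p 0)
    uncons []      = ≈ₚ-sym (≈ₚ-trans (+ₚ-cong (X*≈0∷ []) (≈ₚ-refl {const 0#})) (≈ₚ-trans (∷-cong (+-identityˡ 0#) ≈ₚ-refl) const-0))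
    uncons (a ∷ p) = ≈ₚ-sym (≈ₚ-trans (+ₚ-cong (X*≈0∷ p) (≈ₚ-refl {const a})) (∷-cong (+-identityˡ a) (+ₚ-identityʳ p)))

    tail-below : ∀ p k → coeff p (suc k) ≈ 0# → coeff (tailₚ p) k ≈ 0#
    tail-below []      k e = e
    tail-below (a ∷ p) k e = e

    mv-A-const : ∀ r i → mv A (λ j → const (r j)) i ≈ₚ X *ₚ const (r i) +ₚ -ₚ const (mvᴿ C r i)
    mv-A-const r i = ≈ₚ-trans (mv-A (λ j → const (r j)) i)
      (+ₚ-cong {X *ₚ const (r i)} {X *ₚ const (r i)} ≈ₚ-refl
        (-ₚ-cong {mv Cₚ (λ j → const (r j)) i} {const (mvᴿ C r i)} (≈ₚ-sym (const-sum-* (C i) r))))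

    step : ∀ p → Remainder (λ i → tailₚ (p i)) → Remainder p
    -- As x r = A r + C r, the quotient becomes x q + r and the remainder C r + b, which is again
    -- constant.
    step p (q , r , e) = (λ j → X *ₚ q j +ₚ const (r j)) , (λ i → mvᴿ C r i + coeff (p i) 0) , λ i →
      shift-remainder polyRing X (mv A q i) (const (r i)) (const (mvᴿ C r i)) (const (coeff (p i) 0))
        {p i} {tailₚ (p i)} {mv A (λ j → X *ₚ q j +ₚ const (r j)) i} {mv A (λ j → X *ₚ q j) i} {mv A (λ j → const (r j)) i}
        (uncons (p i)) (e i) (mv-+ A (λ j → X *ₚ q j) (λ j → const (r j)) i) (mv-* A X q i) (mv-A-const r i)

    go : ∀ K (p : Vector Poly n) → (∀ i → Below K (p i)) → Remainder p
    go zero    p below = (λ _ → 0ₚ) , (λ _ → 0#) , λ i → ≈ₚ-trans (Below-zero (below i))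
      (≈ₚ-sym (+ₚ-cong (Poly.lin-zeroʳ (A i) (λ j → ≈ₚ-refl {0ₚ})) const-0))
    go (suc K) p below = step p (go K (λ i → tailₚ (p i))
      (λ i k K≤k → tail-below (p i) k (below i (suc k) (s≤s K≤k))))

  -- Modulo the image of `A` a relation is a constant vector; that vector is a relation of the basis
  -- over the base ring, hence zero.
  A-presents-β : A Presents β
  A-presents-β = record { relation = rel ; solve = sol }
    where
    open ≈-Reasoning ≈ᴹ-setoid
    rel : ∀ q → Lₚ.lin (mv A q) β ≈ᴹ 0ᴹ
    rel q = ≈ᴹ-trans (lin-mv β A q) (Lₚ.lin-zeroʳ q ◃A≈0)

    sol : ∀ p → Lₚ.lin p β ≈ᴹ 0ᴹ → ∃[ q ] (∀ i → mv A q i ≈ₚ p i)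
    sol p pβ≈0 with remainder p
    ... | q , r , e = q , λ i → ≈ₚ-sym (≈ₚ-trans (e i) (≈ₚ-trans (+ₚ-cong {mv A q i} ≈ₚ-refl
                        (≈ₚ-trans (const-cong (linearlyIndependent r rβ≈0 i)) const-0)) (+ₚ-identityʳ (mv A q i))))
      where
      rβ≈0 : L.lin r β ≈ᴹ 0ᴹ
      rβ≈0 = begin
        L.lin r β                                         ≈⟨ lin-const r β ⟨
        Lₚ.lin (λ i → const (r i)) β                      ≈⟨ +ᴹ-identityˡ _ ⟨
        0ᴹ +ᴹ Lₚ.lin (λ i → const (r i)) β                ≈⟨ +ᴹ-congʳ (rel q) ⟨
        Lₚ.lin (mv A q) β +ᴹ Lₚ.lin (λ i → const (r i)) β ≈⟨ Lₚ.lin-+ (mv A q) (λ i → const (r i)) β ⟨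
        Lₚ.lin (λ i → mv A q i +ₚ const (r i)) β          ≈⟨ Lₚ.lin-congʳ β e ⟨
        Lₚ.lin p β                                        ≈⟨ pβ≈0 ⟩
        0ᴹ                                                ∎

-- Diagonal relation matrices and direct sums of cyclic modules.

module DiagonalPresentations {c ℓ m ℓm} {R : CommutativeRing c ℓ} (N : Module R m ℓm) where
  open CommutativeRing R hiding (zero)
  open Module N
  open Matrices R
  open Divisibility semiring using (_∣_; _,_; ∣-trans; module _∣ʳ_)
  open Linear N
  open MatrixProperties R
  open Presentation N
  open _Presents_
  open ≈-Reasoning ≈ᴹ-setoid

  private variable
    n : ℕ

  -- N = ⊕ R wₗ with Ann wₗ = (dₗ)
  record DiagonalPresentation (d : Vector Carrier n) (w : Vector Carrierᴹ n) : Set (c ⊔ ℓ ⊔ m ⊔ ℓm) where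
    field
      spans   : ∀ v → ∃[ p ] lin p w ≈ᴹ v
      kills   : ∀ l → d l *ₗ w l ≈ᴹ 0ᴹ
      divides : ∀ p → lin p w ≈ᴹ 0ᴹ → ∀ l → d l ∣ p l

  open DiagonalPresentation

  *-annihilates : ∀ {a v} r → a *ₗ v ≈ᴹ 0ᴹ → (r * a) *ₗ v ≈ᴹ 0ᴹ
  *-annihilates {a} {v} r av≈0 = ≈ᴹ-trans (*ₗ-assoc r a v) (≈ᴹ-trans (*ₗ-congˡ av≈0) (*ₗ-zeroʳ r))

  ∣-annihilates : ∀ {a b v} → a ∣ b → a *ₗ v ≈ᴹ 0ᴹ → b *ₗ v ≈ᴹ 0ᴹ
  ∣-annihilates (q , qa≈b) av≈0 = ≈ᴹ-trans (*ₗ-congʳ (sym qa≈b)) (*-annihilates q av≈0)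

  diag-presents : {d : Vector Carrier n} {w : Vector Carrierᴹ n} →
                  DiagonalPresentation d w → diag d Presents w
  diag-presents {d = d} {w} dp .relation q = begin
    lin (mv (diag d) q) w    ≈⟨ lin-congʳ w (λ l → trans (mv-diag d q l) (*-comm (d l) (q l))) ⟩
    lin (λ l → q l * d l) w  ≈⟨ sum-zero (λ l → (q l * d l) *ₗ w l) (λ l → *-annihilates (q l) (kills dp l)) ⟩
    0ᴹ                       ∎
  diag-presents {d = d} {w} dp .solve p pw≈0 =
    (λ l → quotient (d∣p l)) , λ l →
      trans (mv-diag d (λ l → quotient (d∣p l)) l) (trans (*-comm (d l) (quotient (d∣p l))) (equality (d∣p l)))
    where
    open _∣ʳ_
    d∣p : ∀ l → d l ∣ p l
    d∣p = divides dp p pw≈0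

  diagonalPresentation : {d : Vector Carrier n} {w : Vector Carrierᴹ n} →
    (∀ v → ∃[ p ] lin p w ≈ᴹ v) → diag d Presents w → DiagonalPresentation d w
  diagonalPresentation spans-w dw .spans = spans-w
  diagonalPresentation {n} {d} {w} spans-w dw .kills l = begin
    d l *ₗ w l                 ≈⟨ *ₗ-congˡ (lin-𝟙ˡ l w) ⟨
    d l *ₗ lin (𝟙 n l) w       ≈⟨ *ₗ-lin (d l) (𝟙 n l) w ⟩
    lin (λ i → d l * 𝟙 n l i) w  ≈⟨ lin-congʳ w (λ i → trans (mv-diag d (λ i → 𝟙 n l i) i) (d*𝟙 i)) ⟨
    lin (mv (diag d) (𝟙 n l)) w  ≈⟨ relation dw (𝟙 n l) ⟩
    0ᴹ                         ∎
    where
    d*𝟙 : ∀ i → d i * 𝟙 n l i ≈ d l * 𝟙 n l i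
    d*𝟙 i with l ≟ i
    ... | yes ≡.refl = refl
    ... | no  _      = trans (zeroʳ (d i)) (sym (zeroʳ (d l)))
  diagonalPresentation {d = d} spans-w dw .divides p pw≈0 l with solve dw p pw≈0
  ... | q , e = q l , trans (*-comm (q l) (d l)) (trans (sym (mv-diag d q l)) (e l))

  -- Each `d l` may be replaced by an associate; this later turns leading coefficient -1 into 1.
  DiagonalPresentation-∣∣ : {d d′ : Vector Carrier n} {w : Vector Carrierᴹ n} →
    (∀ l → d l ∣ d′ l) → (∀ l → d′ l ∣ d l) → DiagonalPresentation d w → DiagonalPresentation d′ w
  DiagonalPresentation-∣∣ d∣d′ d′∣d dp .spans            = spans dp
  DiagonalPresentation-∣∣ d∣d′ d′∣d dp .kills l          = ∣-annihilates (d∣d′ l) (kills dp l)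
  DiagonalPresentation-∣∣ d∣d′ d′∣d dp .divides p pw≈0 l = ∣-trans (d′∣d l) (divides dp p pw≈0 l)

  -- A unit that kills `w zero` forces `w zero` to be 0, so the entry can be removed from every
  -- combination.
  drop-unit : {d : Vector Carrier (suc n)} {w : Vector Carrierᴹ (suc n)} → d zero ∣ 1# →
    DiagonalPresentation d w → DiagonalPresentation (λ l → d (suc l)) (λ l → w (suc l))
  drop-unit {n} {d} {w} d₀∣1 dp = record
    { spans   = λ v → let p , pw≈v = spans dp v in (λ l → p (suc l)) , ≈ᴹ-trans (lin-tail p) pw≈v
    ; kills   = λ l → kills dp (suc l)
    ; divides = λ p pw≈0 l → divides dp (cons p) (≈ᴹ-trans (≈ᴹ-sym (lin-tail (cons p))) pw≈0) (suc l)
    }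
    where
    w₀≈0 : w zero ≈ᴹ 0ᴹ
    w₀≈0 = ≈ᴹ-trans (≈ᴹ-sym (*ₗ-identityˡ (w zero))) (∣-annihilates d₀∣1 (kills dp zero))

    lin-tail : ∀ p → lin (λ l → p (suc l)) (λ l → w (suc l)) ≈ᴹ lin p w
    lin-tail p = ≈ᴹ-sym (≈ᴹ-trans (+ᴹ-congʳ (≈ᴹ-trans (*ₗ-congˡ w₀≈0) (*ₗ-zeroʳ (p zero)))) (+ᴹ-identityˡ _))

    cons : Vector Carrier n → Vector Carrier (suc n)
    cons p zero    = 0#
    cons p (suc l) = p l

  Presents-cong : ∀ {n′} {A B : Matrix n n′} {u} → A ≋ B → A Presents u → B Presents u
  Presents-cong {u = u} A≋B Au .relation q =
    ≈ᴹ-trans (lin-congʳ u (λ i → sym (mv-congʳ q A≋B i))) (relation Au q)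
  Presents-cong A≋B Au .solve p pu≈0 with solve Au p pu≈0
  ... | q , e = q , λ i → trans (sym (mv-congʳ q A≋B i)) (e i)

  -- A vector p is a relation of u P⁻¹ exactly when P⁻¹ p is one of u, hence when it lies in the
  -- image of A. That is also the image of A Q, since Q is onto.
  Presents-equivalent : {A P P⁻¹ Q Q⁻¹ : Matrix n n} {u : Vector Carrierᴹ n} →
    P ⊠ P⁻¹ ≋ 𝟙 n → P⁻¹ ⊠ P ≋ 𝟙 n → Q ⊠ Q⁻¹ ≋ 𝟙 n →
    A Presents u → (P ⊠ A ⊠ Q) Presents (u ◃ P⁻¹)
  Presents-equivalent {n} {A} {P} {P⁻¹} {Q} {Q⁻¹} {u} PP⁻¹ P⁻¹P QQ⁻¹ Au = record { relation = rel ; solve = sol }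
    where
    mv-PAQ : ∀ q i → mv (P ⊠ A ⊠ Q) q i ≈ mv P (mv A (mv Q q)) i
    mv-PAQ q i = trans (mv-⊠ (P ⊠ A) Q q i) (mv-⊠ P A (mv Q q) i)

    mv-inverse : {S T : Matrix n n} → S ⊠ T ≋ 𝟙 n → ∀ p i → mv S (mv T p) i ≈ p i
    mv-inverse {S} {T} ST p i = trans (sym (mv-⊠ S T p i)) (trans (mv-congʳ p ST i) (mv-𝟙 p i))

    rel : ∀ q → lin (mv (P ⊠ A ⊠ Q) q) (u ◃ P⁻¹) ≈ᴹ 0ᴹ
    rel q = begin
      lin (mv (P ⊠ A ⊠ Q) q) (u ◃ P⁻¹)          ≈⟨ lin-mv u P⁻¹ (mv (P ⊠ A ⊠ Q) q) ⟨
      lin (mv P⁻¹ (mv (P ⊠ A ⊠ Q) q)) u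
        ≈⟨ lin-congʳ u (λ i → trans (mv-congˡ P⁻¹ (mv-PAQ q) i) (mv-inverse P⁻¹P (mv A (mv Q q)) i)) ⟩
      lin (mv A (mv Q q)) u                     ≈⟨ relation Au (mv Q q) ⟩
      0ᴹ                                        ∎

    sol : ∀ p → lin p (u ◃ P⁻¹) ≈ᴹ 0ᴹ → ∃[ q ] (∀ i → mv (P ⊠ A ⊠ Q) q i ≈ p i)
    sol p pw≈0 with solve Au (mv P⁻¹ p) (≈ᴹ-trans (lin-mv u P⁻¹ p) pw≈0)
    ... | q , e = mv Q⁻¹ q , λ i → trans (mv-PAQ (mv Q⁻¹ q) i)
      (trans (mv-congˡ P (λ k → trans (mv-congˡ A (mv-inverse QQ⁻¹ q) k) (e k)) i) (mv-inverse PP⁻¹ p i))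

  ◃-spans : {u : Vector Carrierᴹ n} {G H : Matrix n n} → G ⊠ H ≋ 𝟙 n →
            (∀ v → ∃[ p ] lin p u ≈ᴹ v) → ∀ v → ∃[ p ] lin p (u ◃ G) ≈ᴹ v
  ◃-spans {u = u} {G} {H} GH spans-u v with spans-u v
  ... | p , pu≈v = mv H p , ≈ᴹ-trans (≈ᴹ-sym (lin-mv u G (mv H p)))
    (≈ᴹ-trans (lin-congʳ u (λ i → trans (sym (mv-⊠ G H p i)) (trans (mv-congʳ p GH i) (mv-𝟙 p i)))) pu≈v)

-- Square Smith forms as diagonal matrices.

module SmithForm {c ℓ} (R : CommutativeRing c ℓ) where
  open CommutativeRing R hiding (zero)
  open Matrices R
  open MatrixProperties R
  open Divisibility semiring using (∣-respʳ; ∣-respˡ)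
  open Linear (⟨module⟩ {R = R}) using (𝟙-diagonal; 𝟙-off-diagonal)

  -- The diagonal is indexed by `Fin (n ⊓ n)`, not by `Fin n`. Both injections into `Fin n` preserve
  -- `toℕ`, the only datum the chain condition sees.
  smith-diag : ∀ {n} {B : Matrix n n} {d : Vector Carrier n} → B ≋ diag d → DivisibilityChain d → IsSmith B
  smith-diag {n} {B} {d} B≋d chain-d = record { off-diagonal = off ; chain = ch }
    where
    off : ∀ i j → toℕ i ≢ toℕ j → B i j ≈ 0#
    off i j i≢j = trans (B≋d i j)
      (trans (*-congˡ (reflexive (𝟙-off-diagonal i j (λ e → i≢j (≡.cong toℕ e))))) (zeroʳ (d i)))

    entry : ∀ i j → i ≡ j → B i j ≈ d i
    entry i .i ≡.refl = trans (B≋d i i) (trans (*-congˡ (reflexive (𝟙-diagonal i))) (*-identityʳ (d i)))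

    position : Fin (n ℕ.⊓ n) → Fin n
    position i = inject≤ i (ℕ.m⊓n≤m n n)

    diagonal≈ : ∀ i → diagonal B i ≈ d (position i)
    diagonal≈ i = entry _ _ (toℕ-injective (≡.trans (toℕ-inject≤ i _) (≡.sym (toℕ-inject≤ i _))))

    ch : DivisibilityChain (diagonal B)
    ch i j j≡1+i = ∣-respˡ (sym (diagonal≈ i)) (∣-respʳ (sym (diagonal≈ j)) (chain-d (position i) (position j)
      (≡.trans (toℕ-inject≤ j _) (≡.trans j≡1+i (≡.cong suc (≡.sym (toℕ-inject≤ i _)))))))

  smith-diagonal : ∀ {n} {B : Matrix n n} → IsSmith B → B ≋ diag (λ i → B i i)
  smith-diagonal {n} {B} smith i j with i ≟ j
  ... | yes ≡.refl = sym (*-identityʳ (B i i))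
  ... | no  i≢j    = trans (IsSmith.off-diagonal smith i j (λ e → i≢j (toℕ-injective e)))
    (sym (zeroʳ (B i i)))

  smith-chain : ∀ {n} {B : Matrix n n} → IsSmith B → DivisibilityChain (λ i → B i i)
  smith-chain {n} {B} smith i j j≡1+i =
    ∣-respˡ (diagonal≈ i) (∣-respʳ (diagonal≈ j) (IsSmith.chain smith (index i) (index j)
      (≡.trans (toℕ-inject≤ j _) (≡.trans j≡1+i (≡.cong suc (≡.sym (toℕ-inject≤ i _)))))))
    where
    n≤n⊓n : n ≤ n ℕ.⊓ n
    n≤n⊓n = ℕ.≤-reflexive (≡.sym (ℕ.⊓-idem n))

    index : Fin n → Fin (n ℕ.⊓ n)
    index i = inject≤ i n≤n⊓n

    inject≤-index : ∀ i (le : n ℕ.⊓ n ≤ n) → inject≤ (index i) le ≡ i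
    inject≤-index i le = toℕ-injective (≡.trans (toℕ-inject≤ (index i) le) (toℕ-inject≤ i n≤n⊓n))

    diagonal≈ : ∀ i → diagonal B (index i) ≈ B i i
    diagonal≈ i = reflexive (≡.cong₂ B (inject≤-index i (ℕ.m⊓n≤m n n)) (inject≤-index i (ℕ.m⊓n≤n n n)))

-- Rational canonical forms as diagonal presentations.

module RationalForm {c ℓ m ℓm} {R : CommutativeRing c ℓ} (N : Module (Polynomials.polyRing R) m ℓm) where
  open Polynomials R
  open CommutativeRing polyRing using (semiring)
  open Divisibility semiring using (_∣_; _,_; ∣-respʳ)
  open Module N
  open Matrices polyRing using (DivisibilityChain; 𝟙)
  open Modules N
  open Linear N
  open DiagonalPresentations N
  open DiagonalPresentation
  open ≈-Reasoning ≈ᴹ-setoid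
  open Sum +ᴹ-commutativeMonoid using (sum; sum-cong-≋)

  cyclicSubmodule : Carrierᴹ → Submodule (c ⊔ ℓm)
  cyclicSubmodule v = record
    { Member    = λ w → ∃[ r ] r *ₗ v ≈ᴹ w
    ; resp      = λ v≈w (r , e) → r , ≈ᴹ-trans e v≈w
    ; 0ᴹ-closed = 0ₚ , *ₗ-zeroˡ v
    ; +ᴹ-closed = λ (r , e) (s , f) → r +ₚ s , ≈ᴹ-trans (*ₗ-distribʳ v r s) (+ᴹ-cong e f)
    ; *ₗ-closed = λ r (s , e) → r *ₚ s , ≈ᴹ-trans (*ₗ-assoc r s v) (*ₗ-congˡ e)
    }

  hasRCF : ∀ {k} {a : Vector Poly k} {w : Vector Carrierᴹ k} → DiagonalPresentation a w →
           (∀ i → Monic (a i)) → (∀ i → ¬ Constant (a i)) → DivisibilityChain a → HasRCF R N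
  hasRCF {k} {a} {w} dp monic-a nonConstant-a chain-a = record
    { k           = k
    ; V           = λ i → cyclicSubmodule (w i)
    ; cyclic      = λ i → w i , (λ z → z) , (λ z → z)
    ; directSum   = record
      { decompose = λ v → let p , pw≈v = spans dp v in (λ i → p i *ₗ w i) , (λ i → p i , ≈ᴹ-refl) , pw≈v
      ; unique    = uniq
      }
    ; a           = a
    ; annihilator = λ i → ann⇒∣ i , ∣⇒ann i
    ; monic       = monic-a
    ; nonConstant = nonConstant-a
    ; chain       = chain-a
    }
    where
    V : Fin k → Submodule (c ⊔ ℓm)
    V i = cyclicSubmodule (w i)

    -- The coefficientwise difference of two representations is a relation of `w`, so `a i` divides
    -- its entry at i and that entry kills `w i`.
    uniq : ∀ (x y : Vector Carrierᴹ k) → (∀ i → Member (V i) (x i)) → (∀ i → Member (V i) (y i)) →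
           sum x ≈ᴹ sum y → ∀ i → x i ≈ᴹ y i
    uniq x y x∈V y∈V ∑x≈∑y i = -≈0⇒≈ᴹ (begin
      x i +ᴹ -ᴹ y i                       ≈⟨ +ᴹ-cong (≈ᴹ-sym (proj₂ (x∈V i))) (-ᴹ‿cong (≈ᴹ-sym (proj₂ (y∈V i)))) ⟩
      p i *ₗ w i +ᴹ -ᴹ (q i *ₗ w i)       ≈⟨ +ᴹ-congˡ (-‿*ₗ (q i) (w i)) ⟨
      p i *ₗ w i +ᴹ (-ₚ q i) *ₗ w i       ≈⟨ *ₗ-distribʳ (w i) (p i) (-ₚ q i) ⟨
      (p i +ₚ -ₚ q i) *ₗ w i              ≈⟨ ∣-annihilates (divides dp (λ j → p j +ₚ -ₚ q j) difference i) (kills dp i) ⟩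
      0ᴹ                                  ∎)
      where
      p q : Vector Poly k
      p j = proj₁ (x∈V j)
      q j = proj₁ (y∈V j)

      difference : lin (λ j → p j +ₚ -ₚ q j) w ≈ᴹ 0ᴹ
      difference = ≈ᴹ-trans (lin-- p q w) (≈ᴹ⇒-≈0 (≈ᴹ-trans (sum-cong-≋ (λ j → proj₂ (x∈V j)))
        (≈ᴹ-trans ∑x≈∑y (≈ᴹ-sym (sum-cong-≋ (λ j → proj₂ (y∈V j)))))))

    -- The equation r wᵢ = 0 is the relation r eᵢ, whose entry at i is r.
    ann⇒∣ : ∀ i {r} → Ann (V i) r → a i ∣ r
    ann⇒∣ i {r} r-kills = ∣-respʳ r*𝟙 (divides dp (λ j → r *ₚ 𝟙 k i j) (begin
      lin (λ j → r *ₚ 𝟙 k i j) w  ≈⟨ *ₗ-lin r (𝟙 k i) w ⟨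
      r *ₗ lin (𝟙 k i) w          ≈⟨ *ₗ-congˡ (lin-𝟙ˡ i w) ⟩
      r *ₗ w i                    ≈⟨ r-kills (w i) (1ₚ , *ₗ-identityˡ (w i)) ⟩
      0ᴹ                          ∎) i)
      where
      r*𝟙 : r *ₚ 𝟙 k i i ≈ₚ r
      r*𝟙 rewrite 𝟙-diagonal i = *ₚ-identityʳ r

    ∣⇒ann : ∀ i {r} → a i ∣ r → Ann (V i) r
    ∣⇒ann i {r} a∣r v (s , sw≈v) = begin
      r *ₗ v              ≈⟨ *ₗ-congˡ sw≈v ⟨
      r *ₗ s *ₗ w i       ≈⟨ *ₗ-assoc r s (w i) ⟨
      (r *ₚ s) *ₗ w i     ≈⟨ *ₗ-congʳ (*ₚ-comm r s) ⟩
      (s *ₚ r) *ₗ w i     ≈⟨ *-annihilates s (∣-annihilates a∣r (kills dp i)) ⟩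
      0ᴹ                  ∎

  module _ (rcf : HasRCF R N) where
    open HasRCF rcf

    generator : Vector Carrierᴹ k
    generator i = proj₁ (cyclic i)

    generator∈V : ∀ i → Member (V i) (generator i)
    generator∈V i = proj₂ (proj₂ (cyclic i)) (1ₚ , *ₗ-identityˡ (generator i))

    rcf-presentation : DiagonalPresentation a generator
    rcf-presentation .spans v with IsInternalDirectSum.decompose directSum v
    ... | x , x∈V , ∑x≈v = (λ i → proj₁ (multiple i)) , ≈ᴹ-trans (sum-cong-≋ (λ i → proj₂ (multiple i))) ∑x≈v
      where
      multiple : ∀ i → ∃[ r ] r *ₗ generator i ≈ᴹ x i
      multiple i = proj₁ (proj₂ (cyclic i)) (x∈V i)
    rcf-presentation .kills i =
      proj₂ (annihilator i) (1ₚ , *ₚ-identityˡ (a i)) (generator i) (generator∈V i)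
    rcf-presentation .divides p pw≈0 i = proj₁ (annihilator i) λ v v∈V → let s , sg≈v = proj₁ (proj₂ (cyclic i)) v∈V in begin
      p i *ₗ v                     ≈⟨ *ₗ-congˡ sg≈v ⟨
      p i *ₗ s *ₗ generator i      ≈⟨ *ₗ-assoc (p i) s (generator i) ⟨
      (p i *ₚ s) *ₗ generator i    ≈⟨ *ₗ-congʳ (*ₚ-comm (p i) s) ⟩
      (s *ₚ p i) *ₗ generator i    ≈⟨ *-annihilates s (pg≈0 i) ⟩
      0ᴹ                           ∎
      where
      -- Uniqueness compares the given relation with the decomposition of 0 into zeros.
      pg≈0 : ∀ j → p j *ₗ generator j ≈ᴹ 0ᴹ
      pg≈0 = IsInternalDirectSum.unique directSum (λ j → p j *ₗ generator j) (λ _ → 0ᴹ)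
        (λ j → Submodule.*ₗ-closed (V j) (p j) (generator∈V j)) (λ j → Submodule.0ᴹ-closed (V j))
        (≈ᴹ-trans pw≈0 (≈ᴹ-sym (sum-zero {k} (λ _ → 0ᴹ) (λ _ → ≈ᴹ-refl))))

-- Divisors of monic integer polynomials.

module IntegerPolynomials where
  open CommutativeRing ℤ[x] using (semiring; ring)
  open Polynomials ℤ-ring
  open PolynomialProperties ℤ-ring
  open Divisibility semiring using (_∣_; _,_; ∣-refl)
  open RingProperties ring using (-1*x≈-x)

  -- Decidable equality on ℤ allows trailing zeros to be discarded, so a true leading coefficient is
  -- available here.
  leading : ∀ p → p ≈ₚ 0ₚ ⊎ (∃[ n ] coeff p n ≢ 0ℤ × Below (suc n) p)
  leading []      = inj₁ ≈ₚ-refl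
  leading (a ∷ p) with leading p
  ... | inj₂ (n , lead , below) = inj₂ (suc n , lead , λ where (suc k) (s≤s n<k) → below k n<k)
  ... | inj₁ p≈0 with a ℤ.≟ 0ℤ
  ...   | yes a≡0 = inj₁ (≈ₚ-trans (∷-cong a≡0 p≈0) (0∷0≈0 ≈ₚ-refl))
  ...   | no  a≢0 = inj₂ (0 , a≢0 , λ where (suc k) _ → at p≈0 k)

  i*j≡1⇒j≡±1 : ∀ i j → i ℤ.* j ≡ 1ℤ → j ≡ 1ℤ ⊎ j ≡ -1ℤ
  i*j≡1⇒j≡±1 i j ij≡1 = unit j (ℕ.m*n≡1⇒n≡1 ℤ.∣ i ∣ ℤ.∣ j ∣ (≡.trans (≡.sym (ℤ.∣i*j∣≡∣i∣*∣j∣ i j)) (≡.cong ℤ.∣_∣ ij≡1)))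
    where
    unit : ∀ j → ℤ.∣ j ∣ ≡ 1 → j ≡ 1ℤ ⊎ j ≡ -1ℤ
    unit (+ .1)      ≡.refl = inj₁ ≡.refl
    unit -[1+ zero ] ≡.refl = inj₂ ≡.refl

  monic≉0 : ∀ {p} → Monic p → ¬ p ≈ₚ 0ₚ
  monic≉0 (n , lead , _) p≈0 = contradiction (≡.trans (≡.sym lead) (at p≈0 n)) λ ()

  -- Leading coefficients of q and d multiply to a non-zero integer, so the degree of p can be
  -- neither below nor above i + j. The product is then the leading coefficient 1 of p, and its
  -- factors are units.
  leading-unit : ∀ {p} → Monic p → ∀ q d → q *ₚ d ≈ₚ p → ∃[ n ] (coeff d n ≡ 1ℤ ⊎ coeff d n ≡ -1ℤ) × Below (suc n) d
  leading-unit {p} p-monic q d qd≈p with leading q | leading d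
  ... | inj₁ q≈0 | _ = contradiction (≈ₚ-trans (≈ₚ-sym qd≈p) (*ₚ-zeroˡ q d q≈0)) (monic≉0 p-monic)
  ... | inj₂ _   | inj₁ d≈0 =
    contradiction (≈ₚ-trans (≈ₚ-sym qd≈p) (≈ₚ-trans (*ₚ-comm q d) (*ₚ-zeroˡ d q d≈0))) (monic≉0 p-monic)
  ... | inj₂ (i , q-lead , q-below) | inj₂ (j , d-lead , d-below) = j , i*j≡1⇒j≡±1 (coeff q i) (coeff d j) (unit p-monic) , d-below
    where
    top : coeff p (i ℕ.+ j) ≡ coeff q i ℤ.* coeff d j
    top = ≡.trans (≡.sym (at qd≈p (i ℕ.+ j))) (coeff-*-top q d q-below d-below)

    unit : Monic p → coeff q i ℤ.* coeff d j ≡ 1ℤ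
    unit (e , lead , below) with ℕ.<-cmp e (i ℕ.+ j)
    ... | tri≈ _ ≡.refl _ = ≡.trans (≡.sym top) lead
    ... | tri> _ _ i+j<e  = contradiction
      (≡.trans (≡.sym lead) (≡.trans (≡.sym (at qd≈p e)) (Below-* q d q-below d-below e i+j<e))) λ ()
    ... | tri< e<i+j _ _ with ℤ.i*j≡0⇒i≡0∨j≡0 (coeff q i) (≡.trans (≡.sym top) (below _ e<i+j))
    ...   | inj₁ q≡0 = contradiction q≡0 q-lead
    ...   | inj₂ d≡0 = contradiction d≡0 d-lead

  monic-associate : ∀ {d p} → d ∣ p → Monic p → ∃[ d′ ] Monic d′ × d ∣ d′ × d′ ∣ d
  monic-associate {d} (q , qd≈p) p-monic with leading-unit p-monic q d qd≈p
  ... | n , inj₁ lead , below = d , (n , lead , below) , ∣-refl , ∣-refl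
  ... | n , inj₂ lead , below =
    -ₚ d , (n , ≡.trans (coeff-neg d n) (≡.cong ℤ.-_ lead) , λ k n<k → ≡.trans (coeff-neg d k) (≡.cong ℤ.-_ (below k n<k)))
         , (-ₚ 1ₚ , -1*x≈-x d)
         , (-ₚ 1ₚ , ≈ₚ-trans (-1*x≈-x (-ₚ d)) (-‿involutive d))
    where open RingProperties ring using (-‿involutive)

  -- The degree of d exceeds that of e, so the quotient vanishes. This keeps constants out of the
  -- chain behind a non-constant entry.
  constant-multiple≈0 : ∀ {n d e} → IsMonic (suc n) d → d ∣ e → Constant e → e ≈ₚ 0ₚ
  constant-multiple≈0 {n} {d} {e} d-monic (q , qd≈e) (a , e≈a) = ≈ₚ-trans (≈ₚ-sym qd≈e) (*ₚ-zeroˡ q d q≈0)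
    where
    q≈0 : q ≈ₚ 0ₚ
    q≈0 = monic-∣-below q d-monic qd≈e (Below-cong (≈ₚ-sym e≈a) (Below-≤ (const a) (s≤s z≤n) (Below-const a)))

-- From a diagonal presentation to a rational canonical form.

module _ {a ℓ : Level} (N : Module ℤ[x] a ℓ) where
  open CommutativeRing ℤ[x] using (semiring)
  open Polynomials ℤ-ring
  open PolynomialProperties ℤ-ring
  open Divisibility semiring using (_∣_; _,_; ∣-refl; ∣-trans)
  open IntegerPolynomials
  open Module N
  open Matrices ℤ[x]
  open DiagonalPresentations N
  open RationalForm N

  chain-from-zero : ∀ {n} {d : Vector Poly (suc n)} → DivisibilityChain d → ∀ l → d zero ∣ d l
  chain-from-zero {d = d} chain-d = <-weakInduction (λ l → d zero ∣ d l) ∣-refl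
    (λ l d₀∣dₗ → ∣-trans d₀∣dₗ (chain-d (inject₁ l) (suc l) (≡.cong suc (≡.sym (toℕ-inject₁ l)))))

  monicPresentation⇒RCF : ∀ {n} {d : Vector Poly n} {w : Vector Carrierᴹ n} → DiagonalPresentation d w →
    (∀ l → Monic (d l)) → DivisibilityChain d → HasRCF ℤ-ring N
  monicPresentation⇒RCF {zero} dp monic-d chain-d = hasRCF dp monic-d (λ ()) chain-d
  monicPresentation⇒RCF {suc n} {d} dp monic-d chain-d with monic-d zero
  -- A head of positive degree divides every entry; a constant entry would then be 0, contrary to
  -- monicity.
  ... | suc e , d₀-monic = hasRCF dp monic-d
    (λ l constant → monic≉0 (monic-d l) (constant-multiple≈0 d₀-monic (chain-from-zero chain-d l) constant)) chain-d
  -- A monic polynomial of degree 0 is 1, so its summand is zero and is dropped.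
  ... | zero , lead , below = monicPresentation⇒RCF (drop-unit (1ₚ , ≈ₚ-trans (*ₚ-identityˡ (d zero)) d₀≈1) dp)
    (λ l → monic-d (suc l)) (λ i j j≡1+i → chain-d (suc i) (suc j) (≡.cong suc j≡1+i))
    where
    d₀≈1 : d zero ≈ₚ 1ₚ
    d₀≈1 .at zero    = lead
    d₀≈1 .at (suc k) = below (suc k) (s≤s z≤n)

  diagonalPresentation⇒RCF : ∀ {n} {d : Vector Poly n} {w : Vector Carrierᴹ n} → DiagonalPresentation d w →
    DivisibilityChain d → (∃[ p ] Monic p × (∀ v → p *ₗ v ≈ᴹ 0ᴹ)) → HasRCF ℤ-ring N
  diagonalPresentation⇒RCF {n} {d} {w} dp chain-d (p , p-monic , p-kills) = monicPresentation⇒RCF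
    (DiagonalPresentation-∣∣ d∣d′ d′∣d dp) (λ l → proj₁ (proj₂ (associate l)))
    (λ i j j≡1+i → ∣-trans (d′∣d i) (∣-trans (chain-d i j j≡1+i) (d∣d′ j)))
    where
    open Linear N

    d∣p : ∀ l → d l ∣ p
    -- Since p kills every generator, the tuple with all entries p is a relation.
    d∣p l = DiagonalPresentation.divides dp (λ _ → p) (sum-zero (λ l → p *ₗ w l) (λ l → p-kills (w l))) l

    associate : ∀ l → ∃[ d′ ] Monic d′ × d l ∣ d′ × d′ ∣ d l
    associate l = monic-associate (d∣p l) p-monic

    d∣d′ : ∀ l → d l ∣ proj₁ (associate l)
    d∣d′ l = proj₁ (proj₂ (proj₂ (associate l)))

    d′∣d : ∀ l → proj₁ (associate l) ∣ d l
    d′∣d l = proj₂ (proj₂ (proj₂ (associate l)))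

-- From Smith form to rational canonical form.

module _ {a ℓ : Level} (M : Module ℤ-ring a ℓ) {m : ℕ} {β : Vector (Module.Carrierᴹ M) m}
         (β-isBasis : Modules.IsBasis M β) (φ : Modules.End M) where
  open Module M using (Carrierᴹ; _≈ᴹ_; 0ᴹ; ≈ᴹ-trans; ≈ᴹ-sym)
  open Polynomials ℤ-ring
  open Matrices ℤ[x]
  open Modules.IsBasis β-isBasis
  open PolynomialAction M φ
  open Characteristic M φ β-isBasis
  open DiagonalPresentations (polyModule M φ)
  open SmithForm ℤ[x]
  open Linear (polyModule M φ)

  β-spans : ∀ v → ∃[ p ] lin p β ≈ᴹ v
  β-spans v = (λ i → const (coordinates v i)) , ≈ᴹ-trans (lin-const (coordinates v) β) (proj₂ (spanning v))

  annihilating-polynomial : ∃[ p ] Monic p × (∀ v → act M φ p v ≈ᴹ 0ᴹ)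
  annihilating-polynomial with β-annihilated
  ... | p , p-monic , p-kills = p , p-monic , λ v → let q , qβ≈v = β-spans v in
    ≈ᴹ-trans (act-cong M φ p p ≈ₚ-refl (≈ᴹ-sym qβ≈v)) (≈ᴹ-trans (*ₗ-lin′ p q β) (lin-zeroʳ q p-kills))

  SNF⇒RCF : HasSNF A → HasRCF ℤ-ring (polyModule M φ)
  SNF⇒RCF (P , Q , (P⁻¹ , PP⁻¹ , P⁻¹P) , (Q⁻¹ , QQ⁻¹ , _) , smith) =
    diagonalPresentation⇒RCF (polyModule M φ)
      (diagonalPresentation (◃-spans {G = P⁻¹} {P} P⁻¹P β-spans)
        (Presents-cong (smith-diagonal smith) (Presents-equivalent {P = P} {P⁻¹} {Q} {Q⁻¹} PP⁻¹ P⁻¹P QQ⁻¹ A-presents-β)))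
      (smith-chain smith) annihilating-polynomial

-- Flattening a family of finite blocks into one index set.

total : ∀ {k} → (Fin k → ℕ) → ℕ
total {zero}  n = 0
total {suc k} n = n zero ℕ.+ total (λ i → n (suc i))

pair : ∀ {k} (n : Fin k → ℕ) i → Fin (n i) → Fin (total n)
pair n zero    j = j ↑ˡ total (λ i → n (suc i))
pair n (suc i) j = n zero ↑ʳ pair (λ i → n (suc i)) i j

unpair : ∀ {k} (n : Fin k → ℕ) → Fin (total n) → Σ[ i ∈ Fin k ] Fin (n i)
unpair {suc k} n l =
  [ (λ j → zero , j) , (λ l → let i , j = unpair (λ i → n (suc i)) l in suc i , j) ]′ (splitAt (n zero) l)

unpair-pair : ∀ {k} (n : Fin k → ℕ) i j → unpair n (pair n i j) ≡ (i , j)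
unpair-pair n zero    j rewrite splitAt-↑ˡ (n zero) j (total (λ i → n (suc i))) = ≡.refl
unpair-pair n (suc i) j
  rewrite splitAt-↑ʳ (n zero) (total (λ i → n (suc i))) (pair (λ i → n (suc i)) i j)
        | unpair-pair (λ i → n (suc i)) i j = ≡.refl

pair-unpair : ∀ {k} (n : Fin k → ℕ) l → pair n (proj₁ (unpair n l)) (proj₂ (unpair n l)) ≡ l
pair-unpair {suc k} n l =
  ≡.trans (lemma (splitAt (n zero) l)) (join-splitAt (n zero) (total (λ i → n (suc i))) l)
  where
  index : Fin (n zero) ⊎ Fin (total (λ i → n (suc i))) → Σ[ i ∈ Fin (suc k) ] Fin (n i)
  index = [ (λ j → zero , j) , (λ l → let i , j = unpair (λ i → n (suc i)) l in suc i , j) ]′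

  lemma : ∀ s → pair n (proj₁ (index s)) (proj₂ (index s)) ≡ join (n zero) (total (λ i → n (suc i))) s
  lemma (inj₁ j) = ≡.refl
  lemma (inj₂ l) = ≡.cong (n zero ↑ʳ_) (pair-unpair (λ i → n (suc i)) l)

-- Transition matrices between bases.

module BasisChange {c ℓ m ℓm} {R : CommutativeRing c ℓ} (M : Module R m ℓm) where
  open CommutativeRing R hiding (zero)
  open Module M
  open Matrices R
  open Linear M
  open Modules M using (IsBasis)
  open Presentation M
  open ≈-Reasoning ≈ᴹ-setoid
  open Sum +ᴹ-commutativeMonoid using (sum)

  sum-total : ∀ {k} (n : Fin k → ℕ) (f : Vector Carrierᴹ (total n)) →
              sum f ≈ᴹ sum (λ i → sum (λ j → f (pair n i j)))
  sum-total {zero}  n f = ≈ᴹ-refl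
  sum-total {suc k} n f = ≈ᴹ-trans (sum-++ (n zero) f)
    (+ᴹ-congˡ (sum-total (λ i → n (suc i)) (λ l → f (n zero ↑ʳ l))))

  independent-≈ : ∀ {n} {β : Vector Carrierᴹ n} → IsBasis β → ∀ p q → lin p β ≈ᴹ lin q β → ∀ i → p i ≈ q i
  independent-≈ {β = β} basis p q e i = Linear.-≈0⇒≈ᴹ (⟨module⟩ {R = R})
    (IsBasis.linearlyIndependent basis (λ i → p i - q i) (≈ᴹ-trans (lin-- p q β) (≈ᴹ⇒-≈0 e)) i)

  transition : ∀ {n n′} {β : Vector Carrierᴹ n} → IsBasis β → Vector Carrierᴹ n′ → Matrix n n′
  transition basis γ i l = IsBasis.coordinates basis (γ l) i

  ◃-transition : ∀ {n n′} {β : Vector Carrierᴹ n} (basis : IsBasis β) (γ : Vector Carrierᴹ n′) →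
                 ∀ l → (β ◃ transition basis γ) l ≈ᴹ γ l
  ◃-transition basis γ l = proj₂ (IsBasis.spanning basis (γ l))

  -- From β T T′ = γ T′ = β, independence of β gives T T′ = 1. The lengths are allowed to differ,
  -- since `rank-unique` derives their equality from this lemma.
  transition-inverse : ∀ {n n′} {β : Vector Carrierᴹ n} {γ : Vector Carrierᴹ n′}
                       (β-basis : IsBasis β) (γ-basis : IsBasis γ) →
                       transition β-basis γ ⊠ transition γ-basis β ≋ 𝟙 n
  transition-inverse {n} {n′} {β} {γ} β-basis γ-basis i j =
    independent-≈ β-basis (λ i → (T ⊠ T′) i j) (λ i → 𝟙 n i j) (begin
      (β ◃ (T ⊠ T′)) j           ≈⟨ ◃-⊠ β T T′ j ⟩
      ((β ◃ T) ◃ T′) j           ≈⟨ lin-congˡ (λ l → T′ l j) (◃-transition β-basis γ) ⟩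
      (γ ◃ T′) j                 ≈⟨ ◃-transition γ-basis β j ⟩
      β j                        ≈⟨ lin-𝟙ʳ j β ⟨
      lin (λ i → 𝟙 n i j) β      ∎) i
    where
    T : Matrix n n′
    T = transition β-basis γ
    T′ : Matrix n′ n
    T′ = transition γ-basis β

-- Invariance of rank over ℤ.

module Rank {a ℓ} (M : Module ℤ-ring a ℓ) where
  open BasisChange M
  open Matrices ℤ-ring
  open Modules M using (IsBasis)
  open Linear (⟨module⟩ {R = ℤ-ring}) using (𝟙-diagonal)
  open Sum ℤ.+-0-commutativeMonoid using (sum; sum-cong-≋; ∑-comm)
  open ≡-Reasoning

  -- In characteristic zero the trace of the identity determines its size.
  trace-𝟙 : ∀ n → sum (λ i → 𝟙 n i i) ≡ + n
  trace-𝟙 n = ≡.trans (sum-cong-≋ (𝟙-diagonal {n})) (ones n)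
    where
    ones : ∀ n → sum {n} (λ _ → 1ℤ) ≡ + n
    ones zero    = ≡.refl
    ones (suc n) = ≡.cong (λ i → 1ℤ ℤ.+ i) (ones n)

  -- tr (T T′) = tr (T′ T) for the two transition matrices
  rank-unique : ∀ {m n} {β : Vector (Module.Carrierᴹ M) m} {γ : Vector (Module.Carrierᴹ M) n} →
                IsBasis β → IsBasis γ → m ≡ n
  rank-unique {m} {n} {β} {γ} β-basis γ-basis = ℤ.+-injective (begin
    + m                                      ≡⟨ trace-𝟙 m ⟨
    sum (λ i → 𝟙 m i i)                      ≡⟨ sum-cong-≋ (λ i → transition-inverse β-basis γ-basis i i) ⟨
    sum (λ i → sum (λ l → T i l ℤ.* T′ l i)) ≡⟨ ∑-comm (λ i l → T i l ℤ.* T′ l i) ⟩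
    sum (λ l → sum (λ i → T i l ℤ.* T′ l i)) ≡⟨ sum-cong-≋ (λ l → sum-cong-≋ (λ i → ℤ.*-comm (T i l) (T′ l i))) ⟩
    sum (λ l → sum (λ i → T′ l i ℤ.* T i l)) ≡⟨ sum-cong-≋ (λ l → transition-inverse γ-basis β-basis l l) ⟩
    sum (λ l → 𝟙 n l l)                      ≡⟨ trace-𝟙 n ⟩
    + n                                      ∎)
    where
    T : Matrix m n
    T = transition β-basis γ
    T′ : Matrix n m
    T′ = transition γ-basis β

-- The basis adapted to a rational canonical form.

module AdaptedBasis {c ℓ m ℓm} {R : CommutativeRing c ℓ} (M : Module R m ℓm) (φ : Modules.End M)
  {k : ℕ} {a : Vector (Polynomials.Poly R) k} {w : Vector (Module.Carrierᴹ M) k}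
  (presentation : DiagonalPresentations.DiagonalPresentation (polyModule M φ) a w)
  (n : Fin k → ℕ) (a-monic : ∀ i → PolynomialProperties.IsMonic R (suc (n i)) (a i)) where

  open CommutativeRing R hiding (zero)
  open Polynomials R
  open PolynomialProperties R
  open PolynomialAction M φ
  open Module M
  open Modules M using (IsBasis)
  open BasisChange M using (sum-total)
  open DiagonalPresentations (polyModule M φ)
  open DiagonalPresentation
  open Divisibility (CommutativeRing.semiring polyRing) using (_∣_; _,_; 1∣_)
  open Sum +ᴹ-commutativeMonoid using (sum; sum-cong-≋; ∑-distrib-+)

  N : ℕ
  N = total n

  Index : Set
  Index = Fin N ⊎ Fin k

  power : Fin N → Poly
  power q = X^ (suc (toℕ (proj₂ (unpair n q))))

  base : Fin N → Fin k
  base q = proj₁ (unpair n q)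

  -- The exponents in the first block start at 1 because the zeroth powers `w i` form the second.
  -- The `w i` stand last so that the diagonal `δ` begins with its entries 1.
  γᵢ : Index → Carrierᴹ
  γᵢ (inj₁ q) = act M φ (power q) (w (base q))
  γᵢ (inj₂ i) = w i

  γ : Vector Carrierᴹ (N ℕ.+ k)
  γ l = γᵢ (splitAt N l)

  -- The coordinates belonging to wᵢ, x wᵢ, x² wᵢ, …, in this order.
  block : Vector Carrier (N ℕ.+ k) → ∀ i → Vector Carrier (suc (n i))
  block c i zero    = c (N ↑ʳ i)
  block c i (suc j) = c (pair n i j ↑ˡ k)

  -- Coordinates over the base ring, grouped by block, are the coefficients of one polynomial of
  -- degree at most `n i` per generator: exactly the shape of a remainder modulo `a i`.
  lin-γ : ∀ c → L.lin c γ ≈ᴹ Lₚ.lin (λ i → tabulate (block c i)) w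
  lin-γ c = begin
    L.lin c γ
      ≈⟨ L.lin-congʳ γ (λ l → reflexive (≡.cong c (join-splitAt N k l))) ⟨
    L.lin (λ l → c (join N k (splitAt N l))) (λ l → γᵢ (splitAt N l))
      ≈⟨ L.lin-splitAt N {k} (λ s → c (join N k s)) γᵢ ⟩
    sum (λ q → c (q ↑ˡ k) *ₗ γᵢ (inj₁ q)) +ᴹ sum (λ i → c (N ↑ʳ i) *ₗ w i)
      ≈⟨ +ᴹ-congʳ (sum-total n (λ q → c (q ↑ˡ k) *ₗ γᵢ (inj₁ q))) ⟩
    sum (λ i → sum (λ j → c (pair n i j ↑ˡ k) *ₗ γᵢ (inj₁ (pair n i j)))) +ᴹ sum (λ i → c (N ↑ʳ i) *ₗ w i)
      ≈⟨ +ᴹ-comm _ _ ⟩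
    sum (λ i → c (N ↑ʳ i) *ₗ w i) +ᴹ sum (λ i → sum (λ j → c (pair n i j ↑ˡ k) *ₗ γᵢ (inj₁ (pair n i j))))
      ≈⟨ ∑-distrib-+ (λ i → c (N ↑ʳ i) *ₗ w i) (λ i → sum (λ j → c (pair n i j ↑ˡ k) *ₗ γᵢ (inj₁ (pair n i j)))) ⟨
    sum (λ i → c (N ↑ʳ i) *ₗ w i +ᴹ sum (λ j → c (pair n i j ↑ˡ k) *ₗ γᵢ (inj₁ (pair n i j))))
      ≈⟨ sum-cong-≋ (λ i → +ᴹ-cong (*ₗ-congˡ (≈ᴹ-sym (act-identityˡ M φ (w i))))
           (sum-cong-≋ (λ j → *ₗ-congˡ (≈ᴹ-reflexive (γ-pair i j))))) ⟩
    sum (λ i → L.lin (block c i) (λ j → act M φ (X^ (toℕ j)) (w i)))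
      ≈⟨ sum-cong-≋ (λ i → act-tabulate (block c i) (w i)) ⟨
    Lₚ.lin (λ i → tabulate (block c i)) w
      ∎
    where
    open ≈-Reasoning ≈ᴹ-setoid
    γ-pair : ∀ i j → γᵢ (inj₁ (pair n i j)) ≡ act M φ (X^ (suc (toℕ j))) (w i)
    γ-pair i j = ≡.cong (λ (i , j) → act M φ (X^ (suc (toℕ j))) (w i)) (unpair-pair n i j)

  γ-isBasis : IsBasis γ
  γ-isBasis = record { linearlyIndependent = independent ; spanning = spans-γ }
    where
    open ≈-Reasoning ≈ᴹ-setoid

    independent : ∀ c → L.lin c γ ≈ᴹ 0ᴹ → ∀ l → c l ≈ 0#
    independent c cγ≈0 l = trans (reflexive (≡.cong c (≡.sym (join-splitAt N k l)))) (zeros (splitAt N l))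
      where
      -- The block polynomial is a multiple of `a i` of smaller degree than `a i`, hence zero.
      block≈0 : ∀ i j → block c i j ≈ 0#
      block≈0 i with divides presentation (λ i → tabulate (block c i)) (≈ᴹ-trans (≈ᴹ-sym (lin-γ c)) cγ≈0) i
      ... | q , qa≈r = tabulate≈0 (block c i) (≈ₚ-trans (≈ₚ-sym qa≈r) (*ₚ-zeroˡ q (a i)
        (monic-∣-below q (a-monic i) qa≈r (Below-tabulate (block c i)))))

      zeros : ∀ s → c (join N k s) ≈ 0#
      zeros (inj₁ q) = trans (reflexive (≡.cong (λ q → c (q ↑ˡ k)) (≡.sym (pair-unpair n q))))
                             (block≈0 (base q) (suc (proj₂ (unpair n q))))
      zeros (inj₂ i) = block≈0 i zero

    spans-γ : ∀ v → ∃[ c ] L.lin c γ ≈ᴹ v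
    spans-γ v with spans presentation v
    ... | p , pw≈v = g , (begin
      L.lin g γ                                 ≈⟨ lin-γ g ⟩
      Lₚ.lin (λ i → tabulate (block g i)) w
        ≈⟨ sum-cong-≋ (λ i → act-cong M φ (tabulate (block g i)) (tabulate (f i)) (block-g i) ≈ᴹ-refl) ⟩
      Lₚ.lin (λ i → tabulate (f i)) w           ≈⟨ sum-cong-≋ reduce ⟨
      Lₚ.lin p w                                ≈⟨ pw≈v ⟩
      v                                         ∎)
      where
      -- Coordinates of v are the coefficients of the remainders; the multiples of `a i` act as zero
      -- on `w i`.
      f : ∀ i → Vector Carrier (suc (n i))
      f i = proj₁ (proj₂ (divide (a-monic i) (p i)))

      q : Vector Poly k
      q i = proj₁ (divide (a-monic i) (p i))

      gᵢ : Index → Carrier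
      gᵢ (inj₁ l) = f (base l) (suc (proj₂ (unpair n l)))
      gᵢ (inj₂ i) = f i zero

      g : Vector Carrier (N ℕ.+ k)
      g l = gᵢ (splitAt N l)

      block-g≡f : ∀ i j → block g i j ≡ f i j
      block-g≡f i zero    = ≡.cong gᵢ (splitAt-↑ʳ N k i)
      block-g≡f i (suc j) = ≡.trans (≡.cong gᵢ (splitAt-↑ˡ N (pair n i j) k))
        (≡.cong (λ (i , j) → f i (suc j)) (unpair-pair n i j))

      block-g : ∀ i → tabulate (block g i) ≈ₚ tabulate (f i)
      block-g i = CommutativeRing.reflexive polyRing (tabulate-cong (block-g≡f i))

      reduce : ∀ i → act M φ (p i) (w i) ≈ᴹ act M φ (tabulate (f i)) (w i)
      reduce i = begin
        act M φ (p i) (w i)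
          ≈⟨ act-cong M φ (p i) (q i *ₚ a i +ₚ tabulate (f i)) (proj₂ (proj₂ (divide (a-monic i) (p i)))) ≈ᴹ-refl ⟩
        act M φ (q i *ₚ a i +ₚ tabulate (f i)) (w i)                     ≈⟨ act-distribʳ M φ (w i) (q i *ₚ a i) (tabulate (f i)) ⟩
        act M φ (q i *ₚ a i) (w i) +ᴹ act M φ (tabulate (f i)) (w i)     ≈⟨ +ᴹ-congʳ (*-annihilates (q i) (kills presentation i)) ⟩
        0ᴹ +ᴹ act M φ (tabulate (f i)) (w i)                             ≈⟨ +ᴹ-identityˡ _ ⟩
        act M φ (tabulate (f i)) (w i)                                   ∎

  open Matrices polyRing
  open MatrixProperties polyRing
  open Presentation (polyModule M φ)

  δᵢ : Index → Poly
  δᵢ (inj₁ _) = 1ₚ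
  δᵢ (inj₂ i) = a i

  δ : Vector Poly (N ℕ.+ k)
  δ l = δᵢ (splitAt N l)

  zᵢ : Index → Carrierᴹ
  zᵢ (inj₁ _) = 0ᴹ
  zᵢ (inj₂ i) = w i

  z : Vector Carrierᴹ (N ℕ.+ k)
  z l = zᵢ (splitAt N l)

  lin-z : ∀ (pᵢ : Index → Poly) → Lₚ.lin (λ l → pᵢ (splitAt N l)) z ≈ᴹ Lₚ.lin (λ i → pᵢ (inj₂ i)) w
  lin-z pᵢ = ≈ᴹ-trans (Lₚ.lin-splitAt N {k} pᵢ zᵢ)
    (≈ᴹ-trans (+ᴹ-congʳ (Lₚ.lin-zeroʳ (λ q → pᵢ (inj₁ q)) (λ _ → ≈ᴹ-refl))) (+ᴹ-identityˡ _))

  -- The annihilator of a zero generator is the unit ideal, so such generators with relation 1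
  -- change neither the span nor the remaining relations. They raise the length from `k` to the
  -- rank.
  padded : DiagonalPresentation δ z
  padded .spans v with spans presentation v
  ... | p , pw≈v = (λ l → pᵢ (splitAt N l)) , ≈ᴹ-trans (lin-z pᵢ) pw≈v
    where
    pᵢ : Index → Poly
    pᵢ (inj₁ _) = 0ₚ
    pᵢ (inj₂ i) = p i
  padded .kills l with splitAt N l
  ... | inj₁ _ = act-zeroʳ M φ 1ₚ
  ... | inj₂ i = kills presentation i
  padded .divides p pz≈0 l = ≡.subst (λ l′ → δ l ∣ p l′) (join-splitAt N k l) (divides-join (splitAt N l))
    where
    divides-join : ∀ s → δᵢ s ∣ p (join N k s)
    divides-join (inj₁ q) = 1∣ p (q ↑ˡ k)
    divides-join (inj₂ i) = divides presentation (λ i → p (N ↑ʳ i)) (≈ᴹ-trans (≈ᴹ-sym (lin-z (λ s → p (join N k s))))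
      (≈ᴹ-trans (Lₚ.lin-congʳ z (λ l → CommutativeRing.reflexive polyRing (≡.cong p (join-splitAt N k l)))) pz≈0)) i

  δ-injective : Injective (diag δ)
  δ-injective q δq≈0 l = cancel (splitAt N l) (≈ₚ-trans (*ₚ-comm (q l) (δ l)) (≈ₚ-trans (≈ₚ-sym (mv-diag δ q l)) (δq≈0 l)))
    where
    cancel : ∀ s → q l *ₚ δᵢ s ≈ₚ 0ₚ → q l ≈ₚ 0ₚ
    cancel (inj₁ _) e = ≈ₚ-trans (≈ₚ-sym (*ₚ-identityʳ (q l))) e
    cancel (inj₂ i) e = monic-∣-below (q l) (a-monic i) e (Below-0 (suc (n i)))

  δ-chain : DivisibilityChain a → DivisibilityChain δ
  δ-chain chain-a l l′ l′≡1+l = chainᵢ (splitAt N l) (splitAt N l′)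
    (≡.trans (≡.cong toℕ (join-splitAt N k l′)) (≡.trans l′≡1+l (≡.cong suc (≡.cong toℕ (≡.sym (join-splitAt N k l))))))
    where
    chainᵢ : ∀ s s′ → toℕ (join N k s′) ≡ suc (toℕ (join N k s)) → δᵢ s ∣ δᵢ s′
    chainᵢ (inj₁ _) s′        _ = 1∣ δᵢ s′
    -- Every index of the second block exceeds those of the first, so it cannot immediately precede
    -- one of them.
    chainᵢ (inj₂ i) (inj₁ q)  e = contradiction
      (≡.subst (ℕ._< N) (≡.trans (≡.sym (toℕ-↑ˡ q k)) (≡.trans e (≡.cong suc (toℕ-↑ʳ N i)))) (toℕ<n q))
      (ℕ.≤⇒≯ (ℕ.m≤n⇒m≤1+n (ℕ.m≤m+n N (toℕ i))))
    chainᵢ (inj₂ i) (inj₂ i′) e = chain-a i i′ (ℕ.+-cancelˡ-≡ N (toℕ i′) (suc (toℕ i))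
      (≡.trans (≡.sym (toℕ-↑ʳ N i′)) (≡.trans e (≡.trans (≡.cong suc (toℕ-↑ʳ N i)) (≡.sym (ℕ.+-suc N (toℕ i)))))))

  -- γ E = (…, x^(j+1) wᵢ, …, 0, …, 0), so γ (1 − E) = z.
  Eᵢ : Index → Index → Poly
  Eᵢ (inj₂ i) (inj₁ q) = power q *ₚ 𝟙 k i (base q)
  Eᵢ _        _        = 0ₚ

  E : Matrix (N ℕ.+ k) (N ℕ.+ k)
  E l l′ = Eᵢ (splitAt N l) (splitAt N l′)

  -- Non-zero entries lie only in rows of the second block and columns of the first, so no middle
  -- index can link two of them.
  E²≈0 : ∀ l l′ → (E ⊠ E) l l′ ≈ₚ 0ₚ
  E²≈0 l l′ = Linear.sum-zero (⟨module⟩ {R = polyRing}) (λ j → E l j *ₚ E j l′)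
    (λ j → vanish (splitAt N l) (splitAt N j) (splitAt N l′))
    where
    vanish : ∀ s t u → Eᵢ s t *ₚ Eᵢ t u ≈ₚ 0ₚ
    vanish (inj₁ _) (inj₁ _) _ = ≈ₚ-refl
    vanish (inj₂ i) (inj₁ q) _ = *ₚ-zeroʳ (Eᵢ (inj₂ i) (inj₁ q))
    vanish (inj₁ _) (inj₂ _) _ = ≈ₚ-refl
    vanish (inj₂ _) (inj₂ _) _ = ≈ₚ-refl

  z≈γ◃ : ∀ l → z l ≈ᴹ (γ ◃ (𝟙 (N ℕ.+ k) ⊟ E)) l
  z≈γ◃ l = ≈ᴹ-sym (begin
    Lₚ.lin (λ j → 𝟙 (N ℕ.+ k) j l +ₚ -ₚ E j l) γ
      ≈⟨ Lₚ.lin-- (λ j → 𝟙 (N ℕ.+ k) j l) (λ j → E j l) γ ⟩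
    Lₚ.lin (λ j → 𝟙 (N ℕ.+ k) j l) γ +ᴹ -ᴹ Lₚ.lin (λ j → E j l) γ
      ≈⟨ +ᴹ-cong (Lₚ.lin-𝟙ʳ l γ) (-ᴹ‿cong (lin-E (splitAt N l))) ⟩
    γᵢ (splitAt N l) +ᴹ -ᴹ Lₚ.lin (λ i → Eᵢ (inj₂ i) (splitAt N l)) w
      ≈⟨ subtract (splitAt N l) ⟩
    zᵢ (splitAt N l)
      ∎)
    where
    open ≈-Reasoning ≈ᴹ-setoid
    lin-E : ∀ s → Lₚ.lin (λ j → Eᵢ (splitAt N j) s) γ ≈ᴹ Lₚ.lin (λ i → Eᵢ (inj₂ i) s) w
    lin-E s = ≈ᴹ-trans (Lₚ.lin-splitAt N {k} (λ t → Eᵢ t s) γᵢ)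
      (≈ᴹ-trans (+ᴹ-congʳ (Lₚ.lin-zeroˡ (λ q → γᵢ (inj₁ q)) (λ _ → ≈ₚ-refl))) (+ᴹ-identityˡ _))

    subtract : ∀ s → γᵢ s +ᴹ -ᴹ Lₚ.lin (λ i → Eᵢ (inj₂ i) s) w ≈ᴹ zᵢ s
    -- Column q of `E` rebuilds the generator `power q` times `w (base q)` itself, so the difference
    -- is 0.
    subtract (inj₁ q) = L.≈ᴹ⇒-≈0 (≈ᴹ-sym (≈ᴹ-trans (≈ᴹ-sym (Lₚ.*ₗ-lin (power q) (λ i → 𝟙 k i (base q)) w))
      (act-cong M φ (power q) (power q) ≈ₚ-refl (Lₚ.lin-𝟙ʳ (base q) w))))
    subtract (inj₂ i) = begin
      w i +ᴹ -ᴹ Lₚ.lin {k} (λ _ → 0ₚ) w   ≈⟨ +ᴹ-congˡ (-ᴹ‿cong (Lₚ.lin-zeroˡ w (λ _ → ≈ₚ-refl))) ⟩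
      w i +ᴹ -ᴹ 0ᴹ                        ≈⟨ +ᴹ-congʳ (+ᴹ-identityʳ (w i)) ⟨
      w i +ᴹ 0ᴹ +ᴹ -ᴹ 0ᴹ                  ≈⟨ +ᴹ-assoc _ _ _ ⟩
      w i +ᴹ (0ᴹ +ᴹ -ᴹ 0ᴹ)                ≈⟨ +ᴹ-congˡ (-ᴹ‿inverseʳ 0ᴹ) ⟩
      w i +ᴹ 0ᴹ                           ≈⟨ +ᴹ-identityʳ (w i) ⟩
      w i                                 ∎

-- From a rational canonical form to Smith form.

module _ {c ℓ m ℓm} {R : CommutativeRing c ℓ} (M : Module R m ℓm) (φ : Modules.End M) where
  open Polynomials R
  open PolynomialProperties R
  open PolynomialAction M φ
  open Module M
  open Modules M using (IsBasis; matrixOf)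
  open BasisChange M
  open DiagonalPresentations (polyModule M φ)
  open Matrices polyRing
  open MatrixProperties polyRing
  open Presentation (polyModule M φ)

  constTransition : ∀ {n n′} {β : Vector Carrierᴹ n} → IsBasis β → Vector Carrierᴹ n′ → Matrix n n′
  constTransition basis γ i l = const (transition basis γ i l)

  constTransition-inverse : ∀ {n n′} {β : Vector Carrierᴹ n} {γ : Vector Carrierᴹ n′}
    (β-basis : IsBasis β) (γ-basis : IsBasis γ) → constTransition β-basis γ ⊠ constTransition γ-basis β ≋ 𝟙 n
  constTransition-inverse {n} {n′} {β} {γ} β-basis γ-basis i j =
    ≈ₚ-trans (≈ₚ-sym (const-sum-* (transition β-basis γ i) (λ l → transition γ-basis β l j)))
      (≈ₚ-trans (const-cong (transition-inverse β-basis γ-basis i j)) (const-𝟙 i j))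
    where
    const-𝟙 : ∀ {n} (i j : Fin n) → const (Matrices.𝟙 R n i j) ≈ₚ 𝟙 n i j
    const-𝟙 i j with i ≟ j
    ... | yes _ = ≈ₚ-refl
    ... | no  _ = const-0

  ◃-constTransition : ∀ {n n′} {β : Vector Carrierᴹ n} (basis : IsBasis β) (γ : Vector Carrierᴹ n′) →
    ∀ l → (β ◃ constTransition basis γ) l ≈ᴹ γ l
  ◃-constTransition {β = β} basis γ l =
    ≈ᴹ-trans (lin-const (λ i → transition basis γ i l) β) (◃-transition basis γ l)

  ⊠-inverse : ∀ {n} {S S′ T T′ : Matrix n n} → S ⊠ S′ ≋ 𝟙 n → T ⊠ T′ ≋ 𝟙 n → (S ⊠ T) ⊠ (T′ ⊠ S′) ≋ 𝟙 n
  ⊠-inverse {n} {S} {S′} {T} {T′} SS′ TT′ = ≋-trans (⊠-assoc S T (T′ ⊠ S′)) (≋-trans (⊠-congˡ S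
    (≋-trans (≋-sym (⊠-assoc T T′ S′)) (≋-trans (⊠-congʳ S′ TT′) (⊠-identityˡ S′)))) SS′)

  -- The equality of lengths is an argument to be matched with `refl`, which makes the transition
  -- matrices square. As w = β T G, the left Smith factor is H T′, the inverse of T G.
  diagonalPresentation⇒SNF : ∀ {n n′} {β : Vector Carrierᴹ n} {γ w : Vector Carrierᴹ n′} {d : Vector Poly n′} →
    n ≡ n′ → (β-basis : IsBasis β) → IsBasis γ → (G H : Matrix n′ n′) → G ⊠ H ≋ 𝟙 n′ → H ⊠ G ≋ 𝟙 n′ →
    (∀ l → w l ≈ᴹ (γ ◃ G) l) → DiagonalPresentation d w → Injective (diag d) → DivisibilityChain d →
    HasSNF (characteristicMatrix R (matrixOf β-basis φ))
  diagonalPresentation⇒SNF {n} {β = β} {γ} {w} {d} ≡.refl β-basis γ-basis G H GH HG w≈γG dp d-inj chain-d =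
    let Q , Q-inv , HAQ≋D = presentations-equivalent {G = T ⊠ G} {H ⊠ T′} TGHT′ HT′TG w≈βTG
                              A-presents-β A-injective (diag-presents dp) d-inj
    in H ⊠ T′ , Q , (T ⊠ G , HT′TG , TGHT′) , Q-inv , SmithForm.smith-diag polyRing HAQ≋D chain-d
    where
    open Characteristic M φ β-basis

    T T′ : Matrix n n
    T  = constTransition β-basis γ
    T′ = constTransition γ-basis β

    TGHT′ : (T ⊠ G) ⊠ (H ⊠ T′) ≋ 𝟙 n
    TGHT′ = ⊠-inverse {S = T} {T′} {G} {H} (constTransition-inverse β-basis γ-basis) GH

    HT′TG : (H ⊠ T′) ⊠ (T ⊠ G) ≋ 𝟙 n
    HT′TG = ⊠-inverse {S = H} {G} {T′} {T} HG (constTransition-inverse γ-basis β-basis)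

    w≈βTG : ∀ l → w l ≈ᴹ (β ◃ (T ⊠ G)) l
    w≈βTG l = ≈ᴹ-trans (w≈γG l) (≈ᴹ-sym (≈ᴹ-trans (◃-⊠ β T G l)
      (Lₚ.lin-congˡ (λ j → G j l) (◃-constTransition β-basis γ))))

RCF⇒SNF : ∀ {a ℓ} (M : Module ℤ-ring a ℓ) {m : ℕ} {β : Vector (Module.Carrierᴹ M) m}
  (β-isBasis : Modules.IsBasis M β) (φ : Modules.End M) → HasRCF ℤ-ring (polyModule M φ) →
  Matrices.HasSNF ℤ[x] (characteristicMatrix ℤ-ring (Modules.matrixOf M β-isBasis φ))
RCF⇒SNF M β-isBasis φ rcf = diagonalPresentation⇒SNF M φ
  (Rank.rank-unique M β-isBasis γ-isBasis) β-isBasis γ-isBasis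
  (𝟙 _ ⊟ E) (λ i j → 𝟙 _ i j +ₚ E i j) (unipotentˡ {E = E} E²≈0) (unipotentʳ {E = E} E²≈0)
  z≈γ◃ padded δ-injective (δ-chain (HasRCF.chain rcf))
  where
  open HasRCF rcf using (monic; nonConstant)
  open Polynomials ℤ-ring using (_+ₚ_)
  open PolynomialProperties ℤ-ring using (nonConstant-degree)
  open Matrices ℤ[x] using (𝟙; _⊟_)
  open MatrixProperties ℤ[x] using (unipotentˡ; unipotentʳ)
  open AdaptedBasis M φ (RationalForm.rcf-presentation (polyModule M φ) rcf)
    (λ i → proj₁ (nonConstant-degree (monic i) (nonConstant i)))
    (λ i → proj₂ (nonConstant-degree (monic i) (nonConstant i)))

mainTheorem1 : ∀ {a ℓ : Level} (M : Module ℤ-ring a ℓ) (m : ℕ) (β : Vector (Module.Carrierᴹ M) m) (β-isBasis : Modules.IsBasis M β) (φ : Modules.End M) →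
    HasRCF ℤ-ring (polyModule M φ) ⇔ Matrices.HasSNF ℤ[x] (characteristicMatrix ℤ-ring (Modules.matrixOf M β-isBasis φ))
mainTheorem1 M m β β-isBasis φ = mk⇔ (RCF⇒SNF M β-isBasis φ) (SNF⇒RCF M β-isBasis φ)
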